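{- Let $A$ be a finite set with $|A|\ge 2$, let $n\ge 2$, and let $\phi:[n]\to[n]$ have $F$ fixed points and $D$ detached cycles (of length at least $2$). Then the procedural complexity $\mathcal{L}(f^\phi)$ of the manipulation of variables $f^\phi:A^n\to A^n$ is exactly - $n-F+D$ if $\phi$ is a permutation of $[n]$; - $n-F+1$ if $\phi$ is not a permutation and $D>0$; - $n-F$ otherwise.
   Context: $[n]=\{1,\dots,n\}$; the image of $i$ under $\phi:[n]\to[n]$ is written $i\phi$, and $\phi^k$ is the $k$-th iterate. The manipulation of variables induced by $\phi$ is $f^\phi:A^n\to A^n$, $f^\phi(x_1,\dots,x_n)=(x_{1\phi},\dots,x_{n\phi})$. A cycle of $\phi$ is a cycle $(i,i\phi,\dots,i\phi^{k-1})$ with $i\phi^k=i$ (these elements distinct) of the directed graph on $[n]$ with arcs $(i,i\phi)$; it is detached if no element $j\in[n]$ outside the cycle is mapped by $\phi$ to an element of the cycle. Fixed points are not counted as detached cycles, so $D$ counts detached cycles of length $k\ge2$. A transformation of $A^n$ is a map $f=(f_1,\dots,f_n):A^n\to A^n$; its coordinate function $f_i:A^n\to A$ is trivial if $f_i(x)=x_i$ for all $x$. An instruction is a transformation of $A^n$ with at most one nontrivial coordinate function. A program of length $L$ computing $f$ is a sequence of instructions $g^1,\dots,g^L$ with $f=g^L\circ\cdots\circ g^1$. The procedural complexity $\mathcal{L}(f)$ is the shortest length of a program computing $f$; the identity has procedural complexity $0$. -}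

module Defs where

open import Level using (Level)
open import Data.Fin using (Fin; _≟_)
open import Data.Fin.Properties using (any?; all?; injective⇒≤)
open import Data.Fin.Subset using (Subset; inside; outside; _∈_; _∉_)
open import Data.Fin.Subset.Properties using (_∈?_)
open import Data.List using (List; []; _∷_; _++_; allFin; filter; length; map)
open import Data.Nat using (ℕ; zero; suc; _≤_; _≤?_; s≤s)
open import Data.Nat.GeneralisedArithmetic using (iterate)
open import Data.Nat.Properties using (anyUpTo?)
open import Data.Product using (_×_; _,_; proj₁; ∃; ∃-syntax)
open import Data.Vec as Vec using (Vec; lookup; tabulate)
import Data.Vec.Membership.DecPropositional as DecMembership
import Data.Vec.Membership.Propositional as VecMembership
open import Data.Vec.Relation.Unary.AllPairs using (allPairs?)
open import Data.Vec.Relation.Unary.Unique.Propositional using (Unique)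
open import Data.Vec.Relation.Unary.Unique.Propositional.Properties using (lookup-injective)
open import Function using (_⇔_; mk⇔; Equivalence)
open import Function.Definitions using (Bijective)
open import Relation.Binary.PropositionalEquality using (_≡_; _≗_)
open import Relation.Nullary using (¬_; Dec; ¬?)
open import Relation.Nullary.Decidable using (map′; _×-dec_; _→-dec_)

private
  variable
    a : Level
    A : Set a
    n : ℕ

Transformation : Set a → ℕ → Set a
Transformation A n = Vec A n → Vec A n

manipulation : (Fin n → Fin n) → Transformation A n
manipulation φ x = tabulate (λ i → lookup x (φ i))

IsTrivialAt : Transformation A n → Fin n → Set _
IsTrivialAt f i = ∀ x → lookup (f x) i ≡ lookup x i

IsInstruction : Transformation A n → Set _
IsInstruction f = ∀ i j → ¬ IsTrivialAt f i → ¬ IsTrivialAt f j → i ≡ j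

Instruction : Set a → ℕ → Set a
Instruction A n = ∃[ f ] IsInstruction {A = A} {n = n} f

Program : Set a → ℕ → ℕ → Set a
Program A n L = Vec (Instruction A n) L

-- The head of the vector is the instruction applied first:
-- run (g¹ ∷ … ∷ gᴸ ∷ []) = gᴸ ∘ … ∘ g¹.
run : ∀ {L} → Program A n L → Transformation A n
run Vec.[]       x = x
run (g Vec.∷ gs) x = run gs (proj₁ g x)

Computes : ∀ {L} → Program A n L → Transformation A n → Set _
Computes p f = run p ≗ f

HasProceduralComplexity : Transformation A n → ℕ → Set _
HasProceduralComplexity {A = A} {n = n} f L =
  (∃[ p ] Computes {L = L} p f) ×
  (∀ {M} (p : Program A n M) → Computes p f → L ≤ M)

IsPermutation : (Fin n → Fin n) → Set
IsPermutation = Bijective _≡_ _≡_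

#fixedPoints : (Fin n → Fin n) → ℕ
#fixedPoints {n} φ = length (filter (λ i → φ i ≟ i) (allFin n))

-- A cycle (i, iφ, …, iφᵏ⁻¹) is considered up to rotation.  Given φ, it is then
-- determined by its set of elements, so cycles are represented, and counted,
-- as subsets of Fin n.
IsCycle : (Fin n → Fin n) → ℕ → Subset n → Set
IsCycle φ k S = 1 ≤ k × ∃[ i ]
  ( iterate φ i k ≡ i
  × Unique (Vec.iterate φ i k)
  × (∀ j → j ∈ S ⇔ j VecMembership.∈ Vec.iterate φ i k))

IsDetached : (Fin n → Fin n) → Subset n → Set
IsDetached φ S = ∀ j → j ∉ S → φ j ∉ S

-- Fixed points, i.e. cycles of length 1, are excluded.
IsDetachedCycle : (Fin n → Fin n) → Subset n → Set
IsDetachedCycle φ S = (∃[ k ] 2 ≤ k × IsCycle φ k S) × IsDetached φ S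

isCycle? : (φ : Fin n → Fin n) (k : ℕ) (S : Subset n) → Dec (IsCycle φ k S)
isCycle? φ k S = (1 ≤? k) ×-dec any? (λ i →
  (iterate φ i k ≟ i)
  ×-dec allPairs? (λ x y → ¬? (x ≟ y)) (Vec.iterate φ i k)
  ×-dec all? (λ j → let d = j ∈? S
                        e = DecMembership._∈?_ _≟_ j (Vec.iterate φ i k)
                    in map′ (λ (to , from) → mk⇔ to from)
                            (λ eq → Equivalence.to eq , Equivalence.from eq)
                            ((d →-dec e) ×-dec (e →-dec d))))

cycleLength≤n : {φ : Fin n → Fin n} {k : ℕ} {S : Subset n} → IsCycle φ k S → k ≤ n
cycleLength≤n (_ , _ , _ , unique , _) =
  injective⇒≤ (λ {i} {j} → lookup-injective unique i j)

isDetachedCycle? : (φ : Fin n → Fin n) (S : Subset n) → Dec (IsDetachedCycle φ S)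
isDetachedCycle? {n} φ S =
  map′ (λ (k , _ , p) → k , p)
       (λ (k , 2≤k , c) → k , s≤s (cycleLength≤n {φ = φ} {S = S} c) , 2≤k , c)
       (anyUpTo? (λ k → (2 ≤? k) ×-dec isCycle? φ k S) (suc n))
  ×-dec all? (λ j → ¬? (j ∈? S) →-dec ¬? (φ j ∈? S))

allSubsets : (n : ℕ) → List (Subset n)
allSubsets zero    = Vec.[] ∷ []
allSubsets (suc n) = map (inside Vec.∷_) (allSubsets n) ++ map (outside Vec.∷_) (allSubsets n)

#detachedCycles : (Fin n → Fin n) → ℕ
#detachedCycles {n} φ = length (filter (isDetachedCycle? φ) (allSubsets n))

{-# OPTIONS --safe #-}

-- Upper bounds.  A cell ℓ that nobody reads may be set to x (φ ℓ) at once, and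
-- the other readers of the cell φ ℓ may then read ℓ instead; without detached
-- cycles this never gets stuck.  A detached cycle of length k takes k + 1
-- instructions: in an abelian group structure on A, overwrite one of its cells
-- by the sum of all cells and go backwards along the cycle, each time
-- recovering the one missing value from the sum.  If some cell is outside the
-- image of φ, it can keep one such sum for all detached cycles together.
--
-- Lower bounds.  Every moved cell has to be updated.  In a detached cycle
-- containing no cell updated twice, consider the first update, x i ↦ x (φ i).
-- If φ is a permutation, this update is not injective.  In general, if no cell
-- at all is updated twice, then no cell holds x i any more.
module Submission where

open import Defs
open import Level using (Level)
open import Algebra.Bundles using (CommutativeMonoid)
open import Algebra.Properties.CommutativeSemigroup using (x∙yz≈y∙xz)
import Algebra.Properties.CommutativeMonoid.Sum as Sum
open import Algebra.Structures using (IsAbelianGroup)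
open import Data.Bool as Bool using (Bool; true; false; if_then_else_; not)
open import Data.Empty using (⊥-elim)
open import Data.Fin using (Fin; zero; suc; toℕ; fromℕ<; punchIn; finToFun; funToFin; _≟_)
open import Data.Fin.Permutation using (transpose)
import Data.Fin.Permutation.Components as PC
open import Data.Fin.Properties
  using ( any?; all?; pigeonhole; punchInᵢ≢i; toℕ<n; toℕ-fromℕ<; toℕ-injective
        ; finToFun-funToFin)
open import Data.Fin.Subset using (Subset; inside; outside; _∈_; _∉_)
open import Data.Fin.Subset.Properties using (_∈?_; ⊆-antisym; anySubset?)
open import Data.List using (List; []; _∷_; _++_; allFin; filter; length; map)
import Data.List.Membership.DecPropositional as DecMembershipₗ
open import Data.List.Membership.Propositional using () renaming (_∈_ to _∈ₗ_; _∉_ to _∉ₗ_)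
open import Data.List.Membership.Propositional.Properties
  using (∈-filter⁺; ∈-filter⁻; ∈-++⁺ˡ; ∈-++⁺ʳ; ∈-++⁻; ∈-map⁺; ∈-map⁻; ∈-∃++; ∈-allFin; ∈-length)
open import Data.List.Properties
  using (length-++; length-map; length-tabulate; filter-++; filter-none; map-++)
open import Data.List.Relation.Unary.All as All using (All; []; _∷_)
import Data.List.Relation.Unary.All.Properties as Allₚ
open import Data.List.Relation.Unary.AllPairs using ([]; _∷_)
open import Data.List.Relation.Unary.Any using (here; there)
open import Data.List.Relation.Unary.Unique.Propositional using () renaming (Unique to Uniqueₗ)
import Data.List.Relation.Unary.Unique.Propositional.Properties as Uniqueₗ
open import Data.Nat
  using (ℕ; zero; suc; _+_; _∸_; _^_; _%_; _≤_; _<_; _>_; _≤?_; z≤n; s≤s; NonZero)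
open import Data.Nat.DivMod
  using (_mod_; m%n<n; m<n⇒m%n≡m; m%n%n≡m%n; %-distribˡ-+; [m+n]%n≡m%n)
open import Data.Nat.GeneralisedArithmetic using (iterate)
open import Data.Nat.Induction using (<-rec)
open import Data.Nat.Properties
  using ( ≤-refl; ≤-trans; ≤-reflexive; ≤-pred; <⇒≤; ≮⇒≥; ≰⇒>; n<1+n; 1+n≰n; m≤m+n; m≤n+m
        ; +-comm; +-assoc; +-suc; +-identityʳ; +-mono-≤; +-monoˡ-≤; +-commutativeSemigroup
        ; m≤n⇒∃[o]m+o≡n; m+n∸n≡m; m+[n∸m]≡n; m∸n+n≡m; anyUpTo?; module ≤-Reasoning)
open import Data.Product using (_×_; _,_; proj₁; proj₂; ∃-syntax)
open import Data.Sum using (_⊎_; inj₁; inj₂)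
open import Data.Vec as Vec using (Vec; lookup; _[_]≔_; _∷ʳ_)
open import Data.Vec.Functional using (removeAt)
import Data.Vec.Membership.DecPropositional as DecMembershipᵥ
open import Data.Vec.Membership.Propositional using () renaming (_∈_ to _∈ᵥ_; _∉_ to _∉ᵥ_)
open import Data.Vec.Membership.Propositional.Properties using (∈-toList⁻)
import Data.Vec.Properties as Vecₚ
import Data.Vec.Relation.Unary.All as Allᵥ
open import Data.Vec.Relation.Unary.AllPairs using ([]; _∷_)
open import Data.Vec.Relation.Unary.Any using (here; there)
open import Data.Vec.Relation.Unary.Unique.Propositional using (Unique)
open import Function
  using (_∘_; id; case_of_; mk⇔; _↔_; _⇔_; Equivalence; Inverse; Injective)
open import Relation.Binary using (DecidableEquality)
open import Relation.Binary.PropositionalEquality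
open import Relation.Nullary using (¬_; Dec; yes; no; does; ¬?; contradiction)
open import Relation.Nullary.Decidable
  using (_⊎-dec_; _×-dec_; decidable-stable; dec-true; dec-false)
open import Relation.Unary using (Decidable)

private
  variable
    a ℓp : Level
    A : Set a
    n : ℕ

-- Multiplicities in lists

module Counting {A : Set a} (_≟ₐ_ : DecidableEquality A) where

  count : A → List A → ℕ
  count x = length ∘ filter (x ≟ₐ_)

  count-++ : ∀ x ys zs → count x (ys ++ zs) ≡ count x ys + count x zs
  count-++ x ys zs =
    trans (cong length (filter-++ (x ≟ₐ_) ys zs)) (length-++ (filter (x ≟ₐ_) ys))

  count-∉ : ∀ {x xs} → x ∉ₗ xs → count x xs ≡ 0
  count-∉ x∉xs = cong length (filter-none _ (Allₚ.¬Any⇒All¬ _ x∉xs))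

  ∈⇒0<count : ∀ {x xs} → x ∈ₗ xs → 0 < count x xs
  ∈⇒0<count x∈xs = ∈-length (∈-filter⁺ _ x∈xs refl)

  0<count⇒∈ : ∀ {x} xs → 0 < count x xs → x ∈ₗ xs
  0<count⇒∈ {x} (y ∷ xs) 0<c with x ≟ₐ y
  ... | yes x≡y = here x≡y
  ... | no  _   = there (0<count⇒∈ xs 0<c)

  count-unique : ∀ {x xs} → Uniqueₗ xs → count x xs ≤ 1
  count-unique [] = z≤n
  count-unique {x} {y ∷ xs} (y∉xs ∷ u) with x ≟ₐ y
  ... | yes refl = s≤s (≤-reflexive (count-∉ (Allₚ.All¬⇒¬Any y∉xs)))
  ... | no  _    = count-unique u

  -- The head of `ys` must occur in `xs`; deleting it from `ys` and one occurrence of it from `xs`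
  -- keeps the inequality of multiplicities. Unlike inclusion, multiplicities can charge a cell for
  -- two updates.
  count-≤⇒length-≤ : ∀ ys xs → (∀ y → count y ys ≤ count y xs) → length ys ≤ length xs
  count-≤⇒length-≤ []       _  _ = z≤n
  count-≤⇒length-≤ (y ∷ ys) xs c with ∈-∃++ (0<count⇒∈ xs (≤-trans (∈⇒0<count {xs = y ∷ ys} (here refl)) (c y)))
  ... | ls , rs , refl = subst (suc (length ys) ≤_) (sym (length-insert ls))
          (s≤s (count-≤⇒length-≤ ys (ls ++ rs) (λ z → drop-head z (≤-trans (c z) (≤-reflexive (count-insert z ls))))))
    where
    length-insert : ∀ ls → length (ls ++ y ∷ rs) ≡ suc (length (ls ++ rs))
    length-insert []       = refl
    length-insert (_ ∷ ls) = cong suc (length-insert ls)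
    count-insert : ∀ z ls → count z (ls ++ y ∷ rs) ≡ count z (y ∷ ls ++ rs)
    count-insert z ls = begin
      count z (ls ++ y ∷ rs)                   ≡⟨ count-++ z ls (y ∷ rs) ⟩
      count z ls + count z (y ∷ rs)            ≡⟨ cong (count z ls +_) (count-++ z (y ∷ []) rs) ⟩
      count z ls + (count z (y ∷ []) + count z rs) ≡⟨ x∙yz≈y∙xz +-commutativeSemigroup (count z ls) (count z (y ∷ [])) (count z rs) ⟩
      count z (y ∷ []) + (count z ls + count z rs) ≡⟨ cong (count z (y ∷ []) +_) (count-++ z ls rs) ⟨
      count z (y ∷ []) + count z (ls ++ rs)    ≡⟨ count-++ z (y ∷ []) (ls ++ rs) ⟨
      count z (y ∷ ls ++ rs)                   ∎
      where open ≡-Reasoning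
    drop-head : ∀ z → count z (y ∷ ys) ≤ count z (y ∷ ls ++ rs) → count z ys ≤ count z (ls ++ rs)
    drop-head z le with z ≟ₐ y
    ... | yes _ = ≤-pred le
    ... | no  _ = le

  count-⊆ : ∀ {ys xs} → Uniqueₗ ys → (∀ {y} → y ∈ₗ ys → y ∈ₗ xs) → ∀ y → count y ys ≤ count y xs
  count-⊆ {ys} u ys⊆xs y with 1 ≤? count y ys
  ... | yes 0<c = ≤-trans (count-unique u) (∈⇒0<count (ys⊆xs (0<count⇒∈ ys 0<c)))
  ... | no  0≮c = ≤-trans (≤-reflexive (count-∉ {xs = ys} (0≮c ∘ ∈⇒0<count))) z≤n

  length-⊆ : ∀ {ys xs} → Uniqueₗ ys → (∀ {y} → y ∈ₗ ys → y ∈ₗ xs) → length ys ≤ length xs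
  length-⊆ {ys} {xs} u ys⊆xs = count-≤⇒length-≤ ys xs (count-⊆ u ys⊆xs)

length-filter-complement : {P : A → Set ℓp} (P? : Decidable P) → ∀ xs →
  length (filter (¬? ∘ P?) xs) + length (filter P? xs) ≡ length xs
length-filter-complement P? []       = refl
length-filter-complement P? (x ∷ xs) with does (P? x)
... | true  = trans (+-suc _ _) (cong suc (length-filter-complement P? xs))
... | false = cong suc (length-filter-complement P? xs)

-- The enumeration of all subsets

allSubsets-complete : ∀ (S : Subset n) → S ∈ₗ allSubsets n
allSubsets-complete Vec.[] = here refl
allSubsets-complete (inside Vec.∷ S) = ∈-++⁺ˡ (∈-map⁺ _ (allSubsets-complete S))
allSubsets-complete (outside Vec.∷ S) = ∈-++⁺ʳ _ (∈-map⁺ _ (allSubsets-complete S))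

allSubsets-unique : ∀ n → Uniqueₗ (allSubsets n)
allSubsets-unique zero    = [] ∷ []
allSubsets-unique (suc n) = Uniqueₗ.++⁺
  (Uniqueₗ.map⁺ Vecₚ.∷-injectiveʳ (allSubsets-unique n))
  (Uniqueₗ.map⁺ Vecₚ.∷-injectiveʳ (allSubsets-unique n))
  (λ { (i∈ , o∈) → case (∈-map⁻ _ i∈ , ∈-map⁻ _ o∈) of λ { ((_ , _ , refl) , (_ , _ , ())) } })

-- Iteration of a function on a finite type

iterate-suc : ∀ (f : A → A) x k → iterate f x (suc k) ≡ f (iterate f x k)
iterate-suc f x zero    = refl
iterate-suc f x (suc k) = iterate-suc f (f x) k

iterate-+ : ∀ (f : A → A) x j k → iterate f x (j + k) ≡ iterate f (iterate f x k) j
iterate-+ f x zero    k = refl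
iterate-+ f x (suc j) k = trans (iterate-+ f (f x) j k)
  (cong (λ y → iterate f y j) (iterate-suc f x k))

iterate-injective : ∀ {f : A → A} → Injective _≡_ _≡_ f → ∀ k → Injective _≡_ _≡_ (λ x → iterate f x k)
iterate-injective f-inj zero    eq = eq
iterate-injective f-inj (suc k) eq = f-inj (iterate-injective f-inj k eq)

-- Two of the first `N + 1` iterates share a code by the pigeonhole principle, and injectivity of
-- `f` cancels the initial stretch. The coding makes this apply to cells as well as to whole
-- memories.
iterate-returns : ∀ {N} {code : A → Fin N} → Injective _≡_ _≡_ code →
  ∀ {f : A → A} → Injective _≡_ _≡_ f → ∀ x → ∃[ k ] iterate f x (suc k) ≡ x
iterate-returns {code = code} code-inj {f} f-inj x
  with pigeonhole (n<1+n _) (λ i → code (iterate f x (toℕ i)))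
... | i , j , i<j , eq = toℕ j ∸ suc (toℕ i) , iterate-injective f-inj (toℕ i) (begin
    iterate f (iterate f x (suc d)) (toℕ i) ≡⟨ iterate-+ f x (toℕ i) (suc d) ⟨
    iterate f x (toℕ i + suc d)             ≡⟨ cong (iterate f x) (trans (+-suc (toℕ i) d) (m+[n∸m]≡n i<j)) ⟩
    iterate f x (toℕ j)                     ≡⟨ code-inj eq ⟨
    iterate f x (toℕ i)                     ∎)
  where
  open ≡-Reasoning
  d = toℕ j ∸ suc (toℕ i)

-- A section `g` of `f` is injective, so every `i` returns to itself under `g` and has the form
-- `g y`; hence `g` is a two-sided inverse.
strictlySurjective⇒injective : ∀ {f : Fin n → Fin n} → (∀ j → ∃[ i ] f i ≡ j) → Injective _≡_ _≡_ f
strictlySurjective⇒injective {n} {f} surj {i} {j} fi≡fj = begin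
  i            ≡⟨ g∘f i ⟨
  g (f i)      ≡⟨ cong g fi≡fj ⟩
  g (f j)      ≡⟨ g∘f j ⟩
  j            ∎
  where
  open ≡-Reasoning
  g : Fin n → Fin n
  g = proj₁ ∘ surj
  f∘g : ∀ i → f (g i) ≡ i
  f∘g = proj₂ ∘ surj
  g-inj : Injective _≡_ _≡_ g
  g-inj {i} {j} gi≡gj = trans (sym (f∘g i)) (trans (cong f gi≡gj) (f∘g j))
  g∘f : ∀ i → g (f i) ≡ i
  g∘f i with iterate-returns {code = id} id g-inj i
  ... | k , eq = begin
    g (f i)      ≡⟨ cong (g ∘ f) gy≡i ⟨
    g (f (g y))  ≡⟨ cong g (f∘g y) ⟩
    g y          ≡⟨ gy≡i ⟩
    i            ∎
    where
    y = iterate g i k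
    gy≡i = trans (sym (iterate-suc g i k)) eq

least : {P : ℕ → Set ℓp} → Decidable P → ∀ k → P k → ∃[ m ] P m × (∀ {j} → j < m → ¬ P j)
least {P = P} P? = <-rec _ search
  where
  search : ∀ k → (∀ {j} → j < k → P j → ∃[ m ] P m × (∀ {j} → j < m → ¬ P j)) →
           P k → ∃[ m ] P m × (∀ {j} → j < m → ¬ P j)
  search k rec Pk with anyUpTo? P? k
  ... | yes (j , j<k , Pj) = rec j<k Pj
  ... | no  none           = k , Pk , λ j<k Pj → none (_ , j<k , Pj)

All-iterate : ∀ {P : A → Set ℓp} (f : A → A) m x →
  (∀ j → j < m → P (iterate f x j)) → Allᵥ.All P (Vec.iterate f x m)
All-iterate f zero    x Pf = Allᵥ.[]
All-iterate f (suc m) x Pf = Pf 0 (s≤s z≤n) Allᵥ.∷ All-iterate f m (f x) (λ j j<m → Pf (suc j) (s≤s j<m))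

-- Injectivity carries a return to `f x` back to an equally early return to `x`, so only returns to
-- the starting point have to be excluded.
iterate-unique : ∀ {f : A → A} → Injective _≡_ _≡_ f → ∀ m x →
  (∀ j → suc j < m → iterate f x (suc j) ≢ x) → Unique (Vec.iterate f x m)
iterate-unique f-inj zero x _ = []
iterate-unique {f = f} f-inj (suc m) x noReturn =
  All-iterate f m (f x) (λ j j<m → noReturn j (s≤s j<m) ∘ sym) ∷
  iterate-unique f-inj m (f x) (λ j 1+j<m eq →
    noReturn j (s≤s (<⇒≤ 1+j<m)) (f-inj (trans (sym (iterate-suc f (f x) j)) eq)))

module _ {A : Set a} (f : A → A) where

  ∈-iterate-image : ∀ k {u w} → w ∈ᵥ Vec.iterate f u k →
    f w ∈ᵥ Vec.iterate f u k ⊎ f w ≡ iterate f u k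
  ∈-iterate-image (suc zero)    (here refl) = inj₂ refl
  ∈-iterate-image (suc (suc k)) (here refl) = inj₁ (there (here refl))
  ∈-iterate-image (suc k)       (there w∈) with ∈-iterate-image k w∈
  ... | inj₁ fw∈ = inj₁ (there fw∈)
  ... | inj₂ eq  = inj₂ eq

  ∈-iterate-preimage : ∀ k {u w} → w ∈ᵥ Vec.iterate f u k →
    w ≡ u ⊎ ∃[ p ] p ∈ᵥ Vec.iterate f u k × f p ≡ w
  ∈-iterate-preimage (suc k) (here refl) = inj₁ refl
  ∈-iterate-preimage (suc k) {u} (there w∈) with ∈-iterate-preimage k w∈
  ... | inj₁ refl          = inj₂ (u , here refl , refl)
  ... | inj₂ (p , p∈ , eq) = inj₂ (p , there p∈ , eq)

  iterate-last : ∀ k u → ∃[ p ] p ∈ᵥ Vec.iterate f u (suc k) × f p ≡ iterate f u (suc k)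
  iterate-last zero    u = u , here refl , refl
  iterate-last (suc k) u with iterate-last k (f u)
  ... | p , p∈ , eq = p , there p∈ , eq

  fixed-iterate : ∀ {w} → f w ≡ w → ∀ k → iterate f w k ≡ w
  fixed-iterate fw≡w zero    = refl
  fixed-iterate fw≡w (suc k) rewrite fw≡w = fixed-iterate fw≡w k

  -- The orbit cannot leave a fixed point, so it also ends there.
  ∈-iterate-fixed : ∀ k {u w} → w ∈ᵥ Vec.iterate f u k → f w ≡ w → iterate f u k ≡ w
  ∈-iterate-fixed (suc k) (here refl) fw≡w = fixed-iterate fw≡w (suc k)
  ∈-iterate-fixed (suc k) (there w∈)  fw≡w = ∈-iterate-fixed k w∈ fw≡w

  ∈-iterate-closed : ∀ {P : A → Set ℓp} → (∀ {i} → P i → P (f i)) → ∀ k {u w} →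
    w ∈ᵥ Vec.iterate f u k → P u → P w
  ∈-iterate-closed closed (suc k) (here refl) Pu = Pu
  ∈-iterate-closed closed (suc k) (there w∈)  Pu = ∈-iterate-closed closed k w∈ (closed Pu)

  ∈-iterate-coclosed : ∀ {P : A → Set ℓp} → (∀ {i} → P (f i) → P i) → ∀ k {u w} →
    w ∈ᵥ Vec.iterate f u k → P w → P u
  ∈-iterate-coclosed closed (suc k) (here refl) Pw = Pw
  ∈-iterate-coclosed closed (suc k) (there w∈)  Pw = closed (∈-iterate-coclosed closed k w∈ Pw)

  iterate-cong : ∀ {g : A → A} k {u} → (∀ {w} → w ∈ᵥ Vec.iterate f u k → f w ≡ g w) →
    Vec.iterate f u k ≡ Vec.iterate g u k × iterate f u k ≡ iterate g u k
  iterate-cong zero eq = refl , refl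
  iterate-cong (suc k) eq rewrite sym (eq (here refl)) with iterate-cong k (eq ∘ there)
  ... | eq₁ , eq₂ = cong (_ Vec.∷_) eq₁ , eq₂

-- Moved cells and detached cycles

moved? : ∀ (φ : Fin n → Fin n) → Decidable (λ i → φ i ≢ i)
moved? φ i = ¬? (φ i ≟ i)

moved : (Fin n → Fin n) → List (Fin n)
moved {n} φ = filter (moved? φ) (allFin n)

#moved : (Fin n → Fin n) → ℕ
#moved = length ∘ moved

moved-unique : ∀ (φ : Fin n → Fin n) → Uniqueₗ (moved φ)
moved-unique {n} φ = Uniqueₗ.filter⁺ (moved? φ) (Uniqueₗ.allFin⁺ n)

∈-moved⁺ : ∀ {φ : Fin n → Fin n} {i} → φ i ≢ i → i ∈ₗ moved φ
∈-moved⁺ {φ = φ} φi≢i = ∈-filter⁺ (moved? φ) (∈-allFin _) φi≢i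

∈-moved⁻ : ∀ {φ : Fin n → Fin n} {i} → i ∈ₗ moved φ → φ i ≢ i
∈-moved⁻ {φ = φ} i∈ = proj₂ (∈-filter⁻ (moved? φ) {xs = allFin _} i∈)

#moved≡n∸F : ∀ (φ : Fin n → Fin n) → #moved φ ≡ n ∸ #fixedPoints φ
#moved≡n∸F {n} φ = trans (sym (m+n∸n≡m (#moved φ) (#fixedPoints φ)))
  (cong (_∸ #fixedPoints φ)
    (trans (length-filter-complement (λ i → φ i ≟ i) (allFin n)) (length-tabulate id)))

detachedCycles : (Fin n → Fin n) → List (Subset n)
detachedCycles {n} φ = filter (isDetachedCycle? φ) (allSubsets n)

detachedCycles-unique : ∀ (φ : Fin n → Fin n) → Uniqueₗ (detachedCycles φ)
detachedCycles-unique φ = Uniqueₗ.filter⁺ (isDetachedCycle? φ) (allSubsets-unique _)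

∈-detachedCycles⁺ : ∀ {φ : Fin n → Fin n} {S} → IsDetachedCycle φ S → S ∈ₗ detachedCycles φ
∈-detachedCycles⁺ {φ = φ} d = ∈-filter⁺ (isDetachedCycle? φ) (allSubsets-complete _) d

∈-detachedCycles⁻ : ∀ {φ : Fin n → Fin n} {S} → S ∈ₗ detachedCycles φ → IsDetachedCycle φ S
∈-detachedCycles⁻ {φ = φ} S∈ = proj₂ (∈-filter⁻ (isDetachedCycle? φ) {xs = allSubsets _} S∈)

-- The cycle is cut open at `base`: it has `suc l` cells, and the path of `l` cells starting at
-- `φ base` leads back to `base`. The programs for a cycle treat `base` apart from this path.
record CycleView (φ : Fin n → Fin n) (S : Subset n) : Set where
  field
    base   : Fin n
    l      : ℕ
    1≤l    : 1 ≤ l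
    return : iterate φ (φ base) l ≡ base
    unique : Unique (Vec.iterate φ base (suc l))
    path⁺  : ∀ {i} → i ∈ S → i ∈ᵥ Vec.iterate φ base (suc l)
    path⁻  : ∀ {i} → i ∈ᵥ Vec.iterate φ base (suc l) → i ∈ S

  base∈S : base ∈ S
  base∈S = path⁻ (here refl)

cycleView : ∀ {φ : Fin n → Fin n} {S} → IsDetachedCycle φ S → CycleView φ S
cycleView ((suc l , s≤s 1≤l , _ , c , return , unique , S⇔) , _) = record
  { base = c ; l = l ; 1≤l = 1≤l ; return = return ; unique = unique
  ; path⁺ = Equivalence.to (S⇔ _) ; path⁻ = Equivalence.from (S⇔ _) }

module Cycle {φ : Fin n → Fin n} {S : Subset n} (dc : IsDetachedCycle φ S) where

  open CycleView (cycleView dc) public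

  base-moved : φ base ≢ base
  base-moved with l | 1≤l | unique
  ... | suc _ | _ | (c≢φc Allᵥ.∷ _) ∷ _ = c≢φc ∘ sym

  ∈⇒moved : ∀ {i} → i ∈ S → φ i ≢ i
  ∈⇒moved i∈ φi≡i with trans (sym return) (∈-iterate-fixed φ (suc l) (path⁺ i∈) φi≡i)
  ... | refl = base-moved φi≡i

  image : ∀ {i} → i ∈ S → φ i ∈ S
  image i∈ with ∈-iterate-image φ (suc l) (path⁺ i∈)
  ... | inj₁ φi∈ = path⁻ φi∈
  ... | inj₂ eq  = subst (_∈ S) (sym (trans eq return)) base∈S

  preimage : ∀ {i} → i ∈ S → ∃[ p ] p ∈ S × φ p ≡ i
  preimage i∈ with ∈-iterate-preimage φ (suc l) (path⁺ i∈)
  ... | inj₂ (p , p∈ , eq) = p , path⁻ p∈ , eq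
  ... | inj₁ i≡base with iterate-last φ l base
  ...   | p , p∈ , eq = p , path⁻ p∈ , trans eq (trans return (sym i≡base))

  coimage : ∀ {i} → φ i ∈ S → i ∈ S
  coimage {i} φi∈ with i ∈? S
  ... | yes i∈ = i∈
  ... | no  i∉ = contradiction φi∈ (proj₂ dc i i∉)

  -- A property that `φ` preserves and reflects spreads from `i` back to `base` and from there
  -- forward to `j`. Membership in another detached cycle is such a property.
  meets⇒⊆ : ∀ {P : Fin n → Set} → (∀ {i} → P i → P (φ i)) → (∀ {i} → P (φ i) → P i) →
            ∀ {i j} → i ∈ S → P i → j ∈ S → P j
  meets⇒⊆ {P} P-image P-coimage i∈ Pi j∈ =
    ∈-iterate-closed φ {P = P} P-image (suc l) (path⁺ j∈)
      (∈-iterate-coclosed φ {P = P} P-coimage (suc l) (path⁺ i∈) Pi)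

detachedCycles-disjoint : ∀ {φ : Fin n → Fin n} {S T i} → IsDetachedCycle φ S → IsDetachedCycle φ T →
  i ∈ S → i ∈ T → S ≡ T
detachedCycles-disjoint dS dT i∈S i∈T = ⊆-antisym
  (Cycle.meets⇒⊆ dS {P = _∈ _} (Cycle.image dT) (Cycle.coimage dT) i∈S i∈T)
  (Cycle.meets⇒⊆ dT {P = _∈ _} (Cycle.image dS) (Cycle.coimage dS) i∈T i∈S)

-- Being a cycle depends only on the values at the cells of `S`, so only detachment, which concerns
-- the other cells, has to be supplied for `φ`.
transfer-detachedCycle : ∀ {φ ψ : Fin n → Fin n} {S} → IsDetachedCycle ψ S →
  (∀ {i} → i ∈ S → ψ i ≡ φ i) → (∀ j → j ∉ S → φ j ∉ S) → IsDetachedCycle φ S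
transfer-detachedCycle {φ = φ} {ψ} ((k , 2≤k , 1≤k , c , ret , u , S⇔) , _) agree detached
  with iterate-cong ψ {g = φ} k (λ w∈ → agree (Equivalence.from (S⇔ _) w∈))
... | path≡ , end≡ = (k , 2≤k , 1≤k , c , trans (sym end≡) ret , subst Unique path≡ u ,
                      (λ j → subst (λ v → j ∈ _ ⇔ j ∈ᵥ v) path≡ (S⇔ j))) , detached

fromVec : ∀ {m} → Vec (Fin n) m → Subset n
fromVec v = Vec.tabulate (λ j → does (DecMembershipᵥ._∈?_ _≟_ j v))

∈-fromVec⁺ : ∀ {m} {v : Vec (Fin n) m} {j} → j ∈ᵥ v → j ∈ fromVec v
∈-fromVec⁺ {v = v} {j} j∈ = Vecₚ.lookup⇒[]= j _
  (trans (Vecₚ.lookup∘tabulate _ j) (dec-true (DecMembershipᵥ._∈?_ _≟_ j v) j∈))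

∈-fromVec⁻ : ∀ {m} {v : Vec (Fin n) m} {j} → j ∈ fromVec v → j ∈ᵥ v
∈-fromVec⁻ {v = v} {j} j∈ with DecMembershipᵥ._∈?_ _≟_ j v
                             | trans (sym (Vecₚ.lookup∘tabulate (λ j → does (DecMembershipᵥ._∈?_ _≟_ j v)) j)) (Vecₚ.[]=⇒lookup j∈)
... | yes j∈v | _ = j∈v

-- The orbit of `c` up to its least return time has no repetition. Each of its cells has a
-- predecessor in it, and by injectivity no further preimage, so it is detached.
injective∧moved⇒detachedCycle : ∀ {φ : Fin n → Fin n} → Injective _≡_ _≡_ φ → ∀ {c} → φ c ≢ c →
  ∃[ S ] IsDetachedCycle φ S × c ∈ S
injective∧moved⇒detachedCycle {φ = φ} φ-inj {c} φc≢c
  with iterate-returns {code = id} id φ-inj c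
... | k₀ , ret₀ with least (λ k → iterate φ c (suc k) ≟ c) k₀ ret₀
...   | zero  , ret , _   = contradiction ret φc≢c
...   | suc l , ret , min =
  S , ((suc (suc l) , s≤s (s≤s z≤n) , s≤s z≤n , c , ret , u , λ j → mk⇔ ∈-fromVec⁻ ∈-fromVec⁺) , detached) ,
  ∈-fromVec⁺ {v = Vec.iterate φ c (suc (suc l))} (here refl)
  where
  S = fromVec (Vec.iterate φ c (suc (suc l)))
  u = iterate-unique φ-inj (suc (suc l)) c (λ j 1+j<k → min (≤-pred 1+j<k))
  detached : IsDetached φ S
  detached j j∉ φj∈ with ∈-iterate-preimage φ (suc (suc l)) (∈-fromVec⁻ φj∈)
  ... | inj₂ (p , p∈ , φp≡φj) = j∉ (subst (_∈ S) (φ-inj φp≡φj) (∈-fromVec⁺ p∈))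
  ... | inj₁ φj≡c with iterate-last φ (suc l) c
  ...   | p , p∈ , φp≡ = j∉ (subst (_∈ S) (φ-inj (trans φp≡ (trans ret (sym φj≡c)))) (∈-fromVec⁺ p∈))

-- This is what remains to be computed once the cells of `S` have received their final values.
freeze : Subset n → (Fin n → Fin n) → Fin n → Fin n
freeze S φ i = if does (i ∈? S) then i else φ i

freeze-∈ : ∀ {S : Subset n} φ {i} → i ∈ S → freeze S φ i ≡ i
freeze-∈ {S = S} φ {i} i∈ with i ∈? S
... | yes _  = refl
... | no  i∉ = contradiction i∈ i∉

freeze-∉ : ∀ {S : Subset n} φ {i} → i ∉ S → freeze S φ i ≡ φ i
freeze-∉ {S = S} φ {i} i∉ with i ∈? S
... | yes i∈ = contradiction i∈ i∉
... | no  _  = refl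

unique-toList : ∀ {m} {v : Vec A m} → Unique v → Uniqueₗ (Vec.toList v)
unique-toList []      = []
unique-toList (x ∷ u) = Allᵥ-toList x ∷ unique-toList u
  where
  Allᵥ-toList : ∀ {P : A → Set ℓp} {m} {v : Vec A m} → Allᵥ.All P v → All P (Vec.toList v)
  Allᵥ-toList Allᵥ.[] = []
  Allᵥ-toList (px Allᵥ.∷ pxs) = px ∷ Allᵥ-toList pxs

module _ {φ : Fin n → Fin n} {S : Subset n} (dc : IsDetachedCycle φ S) where

  open Cycle dc

  #moved-freeze : suc l + #moved (freeze S φ) ≤ #moved φ
  #moved-freeze = begin
    suc l + #moved ψ                     ≡⟨ cong (_+ #moved ψ) (Vecₚ.length-toList path) ⟨
    length (Vec.toList path) + #moved ψ  ≡⟨ length-++ (Vec.toList path) ⟨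
    length (Vec.toList path ++ moved ψ)  ≤⟨ Counting.length-⊆ _≟_
        (Uniqueₗ.++⁺ (unique-toList unique) (moved-unique ψ)
          (λ (i∈path , i∈ψ) → ∈-moved⁻ i∈ψ (freeze-∈ φ (path⁻ (∈-toList⁻ i∈path)))))
        (λ i∈ → case ∈-++⁻ (Vec.toList path) i∈ of λ
          { (inj₁ i∈path) → ∈-moved⁺ (∈⇒moved (path⁻ (∈-toList⁻ i∈path)))
          ; (inj₂ i∈ψ)    → ∈-moved⁺ (unfreeze-moved (∈-moved⁻ i∈ψ)) }) ⟩
    #moved φ                             ∎
    where
    open ≤-Reasoning
    ψ    = freeze S φ
    path = Vec.iterate φ base (suc l)
    unfreeze-moved : ∀ {i} → ψ i ≢ i → φ i ≢ i
    unfreeze-moved {i} ψi≢i with i ∈? S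
    ... | yes _ = contradiction refl ψi≢i
    ... | no  _ = ψi≢i

  -- The cells of `T` are moved by `freeze S φ`, so `T` avoids `S`. As `φ` maps `S` into itself,
  -- unfreezing adds no arc from `S` to `T`.
  freeze-detachedCycle : ∀ {T} → IsDetachedCycle (freeze S φ) T → IsDetachedCycle φ T
  freeze-detachedCycle {T} dT = transfer-detachedCycle dT
    (λ i∈T → freeze-∉ φ (∈T⇒∉S i∈T)) detached
    where
    ∈T⇒∉S : ∀ {i} → i ∈ T → i ∉ S
    ∈T⇒∉S i∈T i∈S = Cycle.∈⇒moved dT i∈T (freeze-∈ φ i∈S)
    detached : ∀ j → j ∉ T → φ j ∉ T
    detached j j∉T φj∈T with j ∈? S
    ... | yes j∈S = ∈T⇒∉S φj∈T (image j∈S)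
    ... | no  j∉S = proj₂ dT j j∉T (subst (_∈ T) (sym (freeze-∉ φ j∉S)) φj∈T)

  #detachedCycles-freeze : #detachedCycles (freeze S φ) < #detachedCycles φ
  #detachedCycles-freeze = Counting.length-⊆ (Vecₚ.≡-dec Bool._≟_)
    (Allₚ.¬Any⇒All¬ _ S∉ ∷ detachedCycles-unique (freeze S φ))
    (λ { (here refl) → ∈-detachedCycles⁺ dc
       ; (there T∈)  → ∈-detachedCycles⁺ (freeze-detachedCycle (∈-detachedCycles⁻ T∈)) })
    where
    S∉ : S ∉ₗ detachedCycles (freeze S φ)
    S∉ S∈ = Cycle.∈⇒moved (∈-detachedCycles⁻ S∈) base∈S (freeze-∈ φ base∈S)

-- Instructions and programs

lookup-extensionality : ∀ {xs ys : Vec A n} → lookup xs ≗ lookup ys → xs ≡ ys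
lookup-extensionality {xs = xs} {ys} eq =
  trans (sym (Vecₚ.tabulate∘lookup xs)) (trans (Vecₚ.tabulate-cong eq) (Vecₚ.tabulate∘lookup ys))

lookup-manipulation : ∀ (φ : Fin n → Fin n) (x : Vec A n) i →
  lookup (manipulation φ x) i ≡ lookup x (φ i)
lookup-manipulation φ x = Vecₚ.lookup∘tabulate (lookup x ∘ φ)

assign : Fin n → (Vec A n → A) → Instruction A n
assign p h = (λ y → y [ p ]≔ h y) , λ i j i-changes j-changes →
  trans (sym (only-p i-changes)) (only-p j-changes)
  where
  only-p : ∀ {i} → ¬ IsTrivialAt (λ y → y [ p ]≔ h y) i → p ≡ i
  only-p {i} changes = decidable-stable (p ≟ i)
    (λ p≢i → changes (λ x → Vecₚ.lookup∘update′ (p≢i ∘ sym) x (h x)))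

skip : Instruction A n
skip = id , λ i j changes _ → contradiction (λ _ → refl) changes

run-++ : ∀ {L M} (p : Program A n L) (q : Program A n M) x → run (p Vec.++ q) x ≡ run q (run p x)
run-++ Vec.[]       q x = refl
run-++ (g Vec.∷ p) q x = run-++ p q (proj₁ g x)

run-∷ʳ : ∀ {L} (p : Program A n L) g x → run (p ∷ʳ g) x ≡ proj₁ g (run p x)
run-∷ʳ Vec.[]       g x = refl
run-∷ʳ (h Vec.∷ p) g x = run-∷ʳ p g (proj₁ h x)

-- Lengths belong to the type of a program, so an inequality between them is realised by
-- instructions that do nothing.
pad : ∀ {L M} (p : Program A n L) → L ≤ M → ∃[ p′ ] run {L = M} p′ ≗ run p
pad {A = A} {n} {L} p L≤M with m≤n⇒∃[o]m+o≡n L≤M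
... | o , refl rewrite +-comm L o = Vec.replicate o skip Vec.++ p , λ x →
  trans (run-++ (Vec.replicate o skip) p x) (cong (run p) (run-skips o x))
  where
  run-skips : ∀ o x → run {A = A} {n} (Vec.replicate o skip) x ≡ x
  run-skips zero    x = refl
  run-skips (suc o) x = run-skips o x

Computable : Transformation A n → ℕ → Set _
Computable f L = ∃[ p ] Computes {L = L} p f

computable-mono : ∀ {f : Transformation A n} {L M} → L ≤ M → Computable f L → Computable f M
computable-mono L≤M (p , computes) with pad p L≤M
... | p′ , same = p′ , λ x → trans (same x) (computes x)

computable-id : {f : Transformation A n} → (∀ x → f x ≡ x) → Computable f 0
computable-id f≗id = Vec.[] , λ x → sym (f≗id x)

-- Transformations without detached cycles

strictlySurjective∧moved⇒detachedCycle : ∀ {φ : Fin n → Fin n} → (∀ j → ∃[ i ] φ i ≡ j) →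
  ∀ {c} → φ c ≢ c → ∃[ S ] IsDetachedCycle φ S
strictlySurjective∧moved⇒detachedCycle surj φc≢c
  with injective∧moved⇒detachedCycle (strictlySurjective⇒injective surj) φc≢c
... | S , dc , _ = S , dc

source? : ∀ (φ : Fin n → Fin n) → (∃[ ℓ ] ∀ i → φ i ≢ ℓ) ⊎ (∀ j → ∃[ i ] φ i ≡ j)
source? φ with any? (λ ℓ → all? (λ i → ¬? (φ i ≟ ℓ)))
... | yes source = inj₁ source
... | no  none   = inj₂ λ j → decidable-stable (any? (λ i → φ i ≟ j))
                     (λ ∄ → none (j , λ i φi≡j → ∄ (i , φi≡j)))

module Redirect {φ : Fin n → Fin n} {ℓ : Fin n} (source : ∀ i → φ i ≢ ℓ) where

  private
    c = φ ℓ

  -- Once ℓ holds the value of c, every reader of c may read ℓ instead; this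
  -- is done (unless c is fixed) so that a cycle through c does not become
  -- detached when ℓ is finished.
  Redirected : Fin n → Set
  Redirected i = i ≡ ℓ ⊎ φ c ≢ c × φ i ≡ c

  redirected? : Decidable Redirected
  redirected? i = (i ≟ ℓ) ⊎-dec (moved? φ c ×-dec (φ i ≟ c))

  redirect : Fin n → Fin n
  redirect i = if does (redirected? i) then ℓ else φ i

  redirect-yes : ∀ {i} → Redirected i → redirect i ≡ ℓ
  redirect-yes {i} r rewrite dec-true (redirected? i) r = refl

  redirect-no : ∀ {i} → ¬ Redirected i → redirect i ≡ φ i
  redirect-no {i} ¬r rewrite dec-false (redirected? i) ¬r = refl

  redirected⇒reads-c : ∀ {i} → Redirected i → φ i ≡ c
  redirected⇒reads-c (inj₁ refl)       = refl
  redirected⇒reads-c (inj₂ (_ , φi≡c)) = φi≡c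

  redirected⇒moved : ∀ {i} → Redirected i → φ i ≢ i
  redirected⇒moved (inj₁ refl)          = source _
  redirected⇒moved (inj₂ (φc≢c , φi≡c)) φi≡i with trans (sym φi≡i) φi≡c
  ... | refl = φc≢c φi≡c

  redirect-moved : ∀ {i} → redirect i ≢ i → φ i ≢ i
  redirect-moved {i} ψi≢i with redirected? i
  ... | yes r = redirected⇒moved r
  ... | no ¬r = ψi≢i ∘ trans (redirect-no ¬r)

  #moved-redirect : #moved redirect < #moved φ
  #moved-redirect = Counting.length-⊆ _≟_
    (Allₚ.¬Any⇒All¬ _ (λ ℓ∈ → ∈-moved⁻ ℓ∈ (redirect-yes (inj₁ refl))) ∷ moved-unique redirect)
    (λ { (here refl) → ∈-moved⁺ (source ℓ)
       ; (there i∈)  → ∈-moved⁺ (redirect-moved (∈-moved⁻ i∈)) })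

  -- A redirected cell leads to `ℓ`, a fixed point of `redirect`, so no cell of `S` is redirected.
  -- Nor is `c` in `S`: its predecessor there would read `c`, which is moved, and would have been
  -- redirected. Hence redirected cells do not enter `S` under `φ` either.
  redirect-detachedCycle : ∀ {S} → IsDetachedCycle redirect S → IsDetachedCycle φ S
  redirect-detachedCycle {S} dc = transfer-detachedCycle dc
    (λ i∈ → redirect-no (∈⇒¬redirected i∈)) detached
    where
    open Cycle dc
    ∈⇒¬redirected : ∀ {i} → i ∈ S → ¬ Redirected i
    ∈⇒¬redirected i∈ r =
      ∈⇒moved (subst (_∈ S) (redirect-yes r) (image i∈)) (redirect-yes (inj₁ refl))
    c∉S : c ∉ S
    c∉S c∈ with preimage c∈
    ... | p , p∈ , ψp≡c with trans (sym (redirect-no (∈⇒¬redirected p∈))) ψp≡c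
    ...   | φp≡c = ∈⇒¬redirected p∈ (inj₂
             ((λ φc≡c → ∈⇒moved c∈ (trans (redirect-no (∈⇒¬redirected c∈)) φc≡c)) , φp≡c))
    detached : ∀ j → j ∉ S → φ j ∉ S
    detached j j∉ φj∈ with redirected? j
    ... | yes r = c∉S (subst (_∈ S) (redirected⇒reads-c r) φj∈)
    ... | no ¬r = proj₂ dc j j∉ (subst (_∈ S) (sym (redirect-no ¬r)) φj∈)

  manipulation-redirect : ∀ (y : Vec A n) i →
    lookup (y [ ℓ ]≔ lookup y c) (redirect i) ≡ lookup y (φ i)
  manipulation-redirect y i with redirected? i
  ... | yes r = trans (cong (lookup (y [ ℓ ]≔ lookup y c)) (redirect-yes r))
    (trans (Vecₚ.lookup∘update ℓ y _) (cong (lookup y) (sym (redirected⇒reads-c r))))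
  ... | no ¬r = trans (cong (lookup (y [ ℓ ]≔ lookup y c)) (redirect-no ¬r)) (Vecₚ.lookup∘update′ (source i) y _)

-- If some cell is moved, `φ` is not onto, since a permutation would have a detached cycle there. So
-- some cell `ℓ` is read by no cell and may receive its final value first; `redirect` fixes it and
-- moves fewer cells.
noDetachedCycle⇒computable : ∀ L (φ : Fin n → Fin n) → #moved φ ≤ L →
  (∀ {S} → ¬ IsDetachedCycle φ S) → Computable (manipulation {A = A} φ) L
noDetachedCycle⇒computable L φ m≤L ∄dc with any? (moved? φ)
... | no  none = computable-mono z≤n (computable-id (λ x → lookup-extensionality (λ i →
        trans (lookup-manipulation φ x i)
              (cong (lookup x) (decidable-stable (φ i ≟ i) (λ φi≢i → none (i , φi≢i)))))))
... | yes (c , φc≢c) with source? φ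
...   | inj₂ surj = contradiction (proj₂ (strictlySurjective∧moved⇒detachedCycle surj φc≢c)) ∄dc
noDetachedCycle⇒computable zero φ m≤0 ∄dc | yes (c , φc≢c) | inj₁ _ =
  contradiction (≤-trans (∈-length (∈-moved⁺ φc≢c)) m≤0) 1+n≰n
noDetachedCycle⇒computable {n = n} {A = A} (suc L) φ m≤L ∄dc | yes _ | inj₁ (ℓ , source) = result
  where
  open Redirect source
  result : Computable (manipulation {A = A} φ) (suc L)
  result with noDetachedCycle⇒computable {A = A} L redirect
                (≤-pred (≤-trans #moved-redirect m≤L)) (∄dc ∘ redirect-detachedCycle)
  ... | p , computes = assign ℓ (λ y → lookup y (φ ℓ)) Vec.∷ p , λ y →
    trans (computes _) (lookup-extensionality (λ i →
      trans (lookup-manipulation redirect (y [ ℓ ]≔ lookup y (φ ℓ)) i)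
      (trans (manipulation-redirect y i) (sym (lookup-manipulation φ y i)))))

-- Storing sums

module Encoding {A : Set a} {_∙_ : A → A → A} {ε : A} {_⁻¹ : A → A}
  (isAbelianGroup : IsAbelianGroup _≡_ _∙_ ε _⁻¹) where

  open IsAbelianGroup isAbelianGroup using (isCommutativeMonoid; assoc; inverseʳ; identityʳ)

  private
    M : CommutativeMonoid a a
    M = record { isCommutativeMonoid = isCommutativeMonoid }

  open Sum M using (sum; sum-remove; sum-permute; sum-cong-≗)

  mask : (Fin n → Bool) → (Fin n → A) → Fin n → A
  mask W x i = if W i then x i else ε

  total : (Fin n → Bool) → (Fin n → A) → A
  total W x = sum (mask W x)

  -- The memory y stands for the assignment x: the cell ℓ holds the sum of
  -- the x i over i in W, from which x ℓ can be recovered if ℓ is in W.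
  record Encodes (W : Fin n → Bool) (ℓ : Fin n) (x : Fin n → A) (y : Vec A n) : Set a where
    constructor encodes
    field
      off : ∀ i → i ≢ ℓ → lookup y i ≡ x i
      at  : lookup y ℓ ≡ total W x

  encodes-cong : ∀ {W W′ : Fin n → Bool} {ℓ x y} → W ≗ W′ → Encodes W ℓ x y → Encodes W′ ℓ x y
  encodes-cong {x = x} W≗W′ (encodes off at) =
    encodes off (trans at (sum-cong-≗ (λ i → cong (λ b → if b then x i else ε) (W≗W′ i))))

  total-permute : ∀ (W : Fin n → Bool) x ℓ p →
    total W x ≡ total (W ∘ PC.transpose ℓ p) (x ∘ PC.transpose ℓ p)
  total-permute W x ℓ p = sum-permute (mask W x) (transpose ℓ p)

  -- The memory holds the other summands unchanged; removing them from the stored sum leaves the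
  -- summand of `ℓ`, which is `x ℓ` when `ℓ` is in `W`.
  decode : (Fin n → Bool) → Fin n → Vec A n → A
  decode {suc n} W ℓ y = lookup y ℓ ∙ (sum (removeAt (mask W (lookup y)) ℓ) ⁻¹)

  decode-encodes : ∀ {W : Fin n → Bool} {ℓ x y} → W ℓ ≡ true → Encodes W ℓ x y → decode W ℓ y ≡ x ℓ
  decode-encodes {suc n} {W} {ℓ} {x} {y} Wℓ (encodes off at) = begin
    lookup y ℓ ∙ (rest (lookup y) ⁻¹)      ≡⟨ cong₂ (λ s t → s ∙ (t ⁻¹)) at rest≡ ⟩
    total W x ∙ (rest x ⁻¹)                ≡⟨ cong (_∙ (rest x ⁻¹)) (sum-remove {i = ℓ} (mask W x)) ⟩
    (mask W x ℓ ∙ rest x) ∙ (rest x ⁻¹)    ≡⟨ cong (λ b → ((if b then x ℓ else ε) ∙ rest x) ∙ (rest x ⁻¹)) Wℓ ⟩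
    (x ℓ ∙ rest x) ∙ (rest x ⁻¹)           ≡⟨ assoc _ _ _ ⟩
    x ℓ ∙ (rest x ∙ (rest x ⁻¹))           ≡⟨ cong (x ℓ ∙_) (inverseʳ _) ⟩
    x ℓ ∙ ε                                ≡⟨ identityʳ _ ⟩
    x ℓ                                    ∎
    where
    open ≡-Reasoning
    rest : (Fin (suc n) → A) → A
    rest x = sum (removeAt (mask W x) ℓ)
    rest≡ : rest (lookup y) ≡ rest x
    rest≡ = sum-cong-≗ (λ j → cong (λ a → if W (punchIn ℓ j) then a else ε)
              (off (punchIn ℓ j) (punchInᵢ≢i ℓ j)))

  transpose-left : ∀ (ℓ p : Fin n) → PC.transpose ℓ p ℓ ≡ p
  transpose-left ℓ p with ℓ ≟ ℓ
  ... | yes _   = refl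
  ... | no  ℓ≢ℓ = contradiction refl ℓ≢ℓ

  transpose-right : ∀ (ℓ p : Fin n) → PC.transpose ℓ p p ≡ ℓ
  transpose-right ℓ p with p ≟ ℓ
  ... | yes p≡ℓ = p≡ℓ
  ... | no  _ with p ≟ p
  ...   | yes _   = refl
  ...   | no  p≢p = contradiction refl p≢p

  transpose-other : ∀ {ℓ p i : Fin n} → i ≢ ℓ → i ≢ p → PC.transpose ℓ p i ≡ i
  transpose-other {ℓ = ℓ} {p} {i} i≢ℓ i≢p with i ≟ ℓ
  ... | yes i≡ℓ = contradiction i≡ℓ i≢ℓ
  ... | no  _ with i ≟ p
  ...   | yes i≡p = contradiction i≡p i≢p
  ...   | no  _   = refl

  -- Writing x ℓ into p loses x p, but the sum does not change, so that x p
  -- takes the place of x ℓ as the value recoverable from it.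
  encodes-swap : ∀ {W : Fin n → Bool} {ℓ p x y} → W ℓ ≡ true → p ≢ ℓ → Encodes W ℓ x y →
    Encodes (W ∘ PC.transpose ℓ p) ℓ (x ∘ PC.transpose ℓ p) (y [ p ]≔ decode W ℓ y)
  encodes-swap {W = W} {ℓ} {p} {x} {y} Wℓ p≢ℓ enc@(encodes off at) = encodes off′
    (trans (Vecₚ.lookup∘update′ (p≢ℓ ∘ sym) y _) (trans at (total-permute W x ℓ p)))
    where
    off′ : ∀ i → i ≢ ℓ → lookup (y [ p ]≔ decode W ℓ y) i ≡ x (PC.transpose ℓ p i)
    off′ i i≢ℓ with i ≟ p
    ... | yes refl = trans (Vecₚ.lookup∘update p y _)
            (trans (decode-encodes Wℓ enc) (cong x (sym (transpose-right ℓ p))))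
    ... | no  i≢p  = trans (Vecₚ.lookup∘update′ i≢p y _)
            (trans (off i i≢ℓ) (cong x (sym (transpose-other i≢ℓ i≢p))))

  transpose-invariant : ∀ {W : Fin n → Bool} {ℓ p} → W ℓ ≡ true → W p ≡ true → W ∘ PC.transpose ℓ p ≗ W
  transpose-invariant {W = W} {ℓ} {p} Wℓ Wp i with i ≟ ℓ
  ... | yes refl = trans Wp (sym Wℓ)
  ... | no  _ with i ≟ p
  ...   | yes refl = trans Wℓ (sym Wp)
  ...   | no  _    = refl

  allBut : Fin n → Fin n → Bool
  allBut e i = not (does (i ≟ e))

  allBut-≢ : ∀ {e i : Fin n} → i ≢ e → allBut e i ≡ true
  allBut-≢ {e = e} {i} i≢e rewrite dec-false (i ≟ e) i≢e = refl

  allBut-≡ : ∀ (e : Fin n) → allBut e e ≡ false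
  allBut-≡ e rewrite dec-true (e ≟ e) refl = refl

  allBut-sym : ∀ (i j : Fin n) → allBut i j ≡ allBut j i
  allBut-sym i j with j ≟ i
  ... | yes refl = sym (allBut-≡ i)
  ... | no  j≢i  = sym (allBut-≢ (j≢i ∘ sym))

  allBut-transpose : ∀ (ℓ p i : Fin n) → allBut ℓ (PC.transpose ℓ p i) ≡ allBut p i
  allBut-transpose ℓ p i with i ≟ ℓ
  ... | yes refl = allBut-sym i p
  ... | no  i≢ℓ with i ≟ p
  ...   | yes refl = allBut-≡ ℓ
  ...   | no  _    = allBut-≢ i≢ℓ

  allBut-transpose′ : ∀ (ℓ p i : Fin n) → allBut ℓ i ≡ allBut p (PC.transpose ℓ p i)
  allBut-transpose′ ℓ p i with i ≟ ℓ
  ... | yes refl = sym (allBut-≡ p)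
  ... | no  i≢ℓ with i ≟ p
  ...   | yes refl = sym (allBut-≢ (i≢ℓ ∘ sym))
  ...   | no  i≢p  = sym (allBut-≢ i≢p)

  -- The path is treated from its end towards `u`. The recoverable value `x ℓ` is always the one
  -- that the next cell has to receive; writing it there makes the old value of that cell
  -- recoverable, which its predecessor on the path needs. All these cells lie in `W`, so the set of
  -- summands stays the same.
  chain : ∀ (φ : Fin n → Fin n) {W ℓ} → W ℓ ≡ true → ∀ k u → Unique (Vec.iterate φ u k) →
    (∀ {w} → w ∈ᵥ Vec.iterate φ u k → w ≢ ℓ × W w ≡ true) →
    ∃[ P ] ∀ x y → Encodes W ℓ x y → x ℓ ≡ x (iterate φ u k) →
    ∃[ x′ ] Encodes W ℓ x′ (run {L = k} P y) × x′ ℓ ≡ x u ×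
      (∀ {w} → w ∈ᵥ Vec.iterate φ u k → x′ w ≡ x (φ w)) ×
      (∀ {w} → w ∉ᵥ Vec.iterate φ u k → w ≢ ℓ → x′ w ≡ x w)
  chain φ Wℓ zero u _ _ = Vec.[] , λ x y enc xℓ≡xu → x , enc , xℓ≡xu , (λ ()) , λ _ _ → refl
  chain {n} φ {W} {ℓ} Wℓ (suc k) u (u∉path ∷ unique) path-ok
    with chain φ Wℓ k (φ u) unique (path-ok ∘ there)
  ... | P , P-ok = P ∷ʳ assign u (decode W ℓ) , correct
    where
    correct : ∀ x y → Encodes W ℓ x y → x ℓ ≡ x (iterate φ u (suc k)) →
      ∃[ x″ ] Encodes W ℓ x″ (run (P ∷ʳ assign u (decode W ℓ)) y) × x″ ℓ ≡ x u ×
        (∀ {w} → w ∈ᵥ Vec.iterate φ u (suc k) → x″ w ≡ x (φ w)) ×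
        (∀ {w} → w ∉ᵥ Vec.iterate φ u (suc k) → w ≢ ℓ → x″ w ≡ x w)
    correct x y enc xℓ≡ with P-ok x y enc xℓ≡
    ... | x′ , enc′ , x′ℓ , x′-on , x′-off =
      x′ ∘ PC.transpose ℓ u ,
      subst (Encodes W ℓ (x′ ∘ PC.transpose ℓ u)) (sym (run-∷ʳ P (assign u (decode W ℓ)) y))
        (encodes-cong (transpose-invariant Wℓ (proj₂ (path-ok (here refl)))) (encodes-swap Wℓ u≢ℓ enc′)) ,
      trans (cong x′ (transpose-left ℓ u)) (x′-off u∉ u≢ℓ) ,
      on ,
      λ w∉ w≢ℓ → trans (cong x′ (transpose-other w≢ℓ (λ { refl → w∉ (here refl) })))
                   (x′-off (w∉ ∘ there) w≢ℓ)
      where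
      u≢ℓ = proj₁ (path-ok (here refl))
      u∉ : u ∉ᵥ Vec.iterate φ (φ u) k
      u∉ u∈ = Allᵥ.lookup u∉path u∈ refl
      on : ∀ {w} → w ∈ᵥ Vec.iterate φ u (suc k) → x′ (PC.transpose ℓ u w) ≡ x (φ w)
      on (here refl) = trans (cong x′ (transpose-right ℓ u)) x′ℓ
      on (there w∈)  = trans (cong x′ (transpose-other
        (proj₁ (path-ok (there w∈))) (λ { refl → u∉ w∈ }))) (x′-on w∈)

  module _ {φ : Fin n → Fin n} {S : Subset n} (dc : IsDetachedCycle φ S) where

    open Cycle dc

    private
      ψ : Fin n → Fin n
      ψ = freeze S φ

      u : Fin n
      u = φ base

      unique-rest : Unique (Vec.iterate φ u l)
      unique-rest with unique
      ... | _ ∷ u = u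

      ∈rest⇒≢base : ∀ {w} → w ∈ᵥ Vec.iterate φ u l → w ≢ base
      ∈rest⇒≢base w∈ refl with unique
      ... | base∉ ∷ _ = Allᵥ.lookup base∉ w∈ refl

      reads : ∀ {x x′ : Fin n → A} → x′ base ≡ x u →
        (∀ {w} → w ∈ᵥ Vec.iterate φ u l → x′ w ≡ x (φ w)) →
        (∀ {w} → w ∉ S → x′ (φ w) ≡ x (φ w)) →
        ∀ i → x′ (ψ i) ≡ x (φ i)
      reads {x = x} {x′} at-base on off i with i ∈? S
      ... | no  i∉ = off i∉
      ... | yes i∈ with path⁺ i∈
      ...   | here refl = at-base
      ...   | there i∈′ = on i∈′

    -- One instruction stores the sum in `base`, `l` instructions treat the rest of the cycle, and a
    -- last one replaces the sum by the value due to `base`: one more than the cycle has cells.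
    cycle-computable : ∀ {L} → Computable (manipulation {A = A} ψ) L →
      Computable (manipulation {A = A} φ) (suc (suc l) + L)
    cycle-computable {L} (q , q-computes) with chain φ {λ _ → true} {base} refl l u unique-rest
      (λ w∈ → ∈rest⇒≢base w∈ , refl)
    ... | P , P-ok = (store Vec.∷ (P ∷ʳ load)) Vec.++ q , λ y →
      trans (run-++ (store Vec.∷ (P ∷ʳ load)) q y) (trans (q-computes _) (lookup-extensionality (correct y)))
      where
      all : Fin n → Bool
      all _ = true
      store load : Instruction A n
      store = assign base (λ y → total all (lookup y))
      load  = assign base (decode all base)
      correct : ∀ y i → lookup (manipulation ψ (run (P ∷ʳ load) (proj₁ store y))) i ≡ lookup (manipulation φ y) i
      correct y i with P-ok (lookup y) (proj₁ store y)
        (encodes (λ i i≢ → Vecₚ.lookup∘update′ i≢ y _) (Vecₚ.lookup∘update base y _))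
        -- The path ends at `base`, so its last cell needs exactly the value that the sum has
        -- overwritten.
        (cong (lookup y) (sym return))
      ... | x′ , enc , x′-base , x′-on , x′-off = begin
        lookup (manipulation ψ (run (P ∷ʳ load) y₁)) i ≡⟨ lookup-manipulation ψ (run (P ∷ʳ load) y₁) i ⟩
        lookup (run (P ∷ʳ load) y₁) (ψ i)      ≡⟨ cong (λ z → lookup z (ψ i)) (run-∷ʳ P load y₁) ⟩
        lookup (proj₁ load (run P y₁)) (ψ i)   ≡⟨ loaded (ψ i) ⟩
        x′ (ψ i)                               ≡⟨ reads {x = lookup y} {x′} x′-base x′-on off i ⟩
        lookup y (φ i)                         ≡⟨ lookup-manipulation φ y i ⟨
        lookup (manipulation φ y) i            ∎
        where
        open ≡-Reasoning
        y₁ = proj₁ store y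
        loaded : ∀ i → lookup (proj₁ load (run P y₁)) i ≡ x′ i
        loaded i with i ≟ base
        ... | yes refl = trans (Vecₚ.lookup∘update base (run P y₁) _) (decode-encodes refl enc)
        ... | no  i≢   = trans (Vecₚ.lookup∘update′ i≢ (run P y₁) _) (Encodes.off enc i i≢)
        off : ∀ {w} → w ∉ S → x′ (φ w) ≡ lookup y (φ w)
        off w∉ = x′-off (w∉ ∘ coimage ∘ path⁻ ∘ there)
                   (λ φw≡base → w∉ (coimage (subst (_∈ S) (sym φw≡base) base∈S)))

    -- The sum of all other cells held by ℓ is also the sum over all cells but
    -- base when x ℓ is taken to be x base.
    cycle-in-sum : ∀ {ℓ} → (∀ i → φ i ≢ ℓ) → ∃[ P ] ∀ x y → Encodes (allBut ℓ) ℓ x y →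
      ∃[ x′ ] Encodes (allBut ℓ) ℓ x′ (run {L = suc l} P y) × (∀ i → x′ (ψ i) ≡ x (φ i))
    cycle-in-sum {ℓ} source = P ∷ʳ load , correct
      where
      ∈S⇒≢ℓ : ∀ {i} → i ∈ S → i ≢ ℓ
      ∈S⇒≢ℓ i∈ refl with preimage i∈
      ... | p , _ , φp≡ℓ = source p φp≡ℓ
      base≢ℓ : base ≢ ℓ
      base≢ℓ = ∈S⇒≢ℓ base∈S
      load : Instruction A n
      load = assign base (decode (allBut base) ℓ)
      ℓ-stored : allBut base ℓ ≡ true
      ℓ-stored = allBut-≢ (base≢ℓ ∘ sym)
      chained = chain φ {allBut base} {ℓ} ℓ-stored l u unique-rest
        (λ w∈ → ∈S⇒≢ℓ (path⁻ (there w∈)) , allBut-≢ (∈rest⇒≢base w∈))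
      P = proj₁ chained
      correct : ∀ x y → Encodes (allBut ℓ) ℓ x y →
        ∃[ x′ ] Encodes (allBut ℓ) ℓ x′ (run (P ∷ʳ load) y) × (∀ i → x′ (ψ i) ≡ x (φ i))
      correct x y (encodes off at) =
        x′ ∘ PC.transpose ℓ base ,
        subst (Encodes (allBut ℓ) ℓ (x′ ∘ PC.transpose ℓ base)) (sym (run-∷ʳ P load y))
          -- Writing into `base` exchanges the roles of `ℓ` and `base`: the sum over all cells but
          -- `base` becomes one over all cells but `ℓ` again, ready for the next cycle.
          (encodes-cong (λ i → sym (allBut-transpose′ ℓ base i)) (encodes-swap ℓ-stored base≢ℓ enc′)) ,
        reads {x = x} {x′ ∘ PC.transpose ℓ base}
          (trans (cong x′ (transpose-right ℓ base)) (trans x′-ℓ (x₁-off (source base))))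
          (λ {w} w∈ → trans (cong x′ (transpose-other (∈S⇒≢ℓ (path⁻ (there w∈))) (∈rest⇒≢base w∈)))
                        (trans (x′-on w∈) (x₁-off (source w))))
          (λ {w} w∉ → trans (cong x′ (transpose-other (source w) (φw≢base w∉)))
                        (trans (x′-off (w∉ ∘ coimage ∘ path⁻ ∘ there) (source w)) (x₁-off (source w))))
        where
        φw≢base : ∀ {w} → w ∉ S → φ w ≢ base
        φw≢base w∉ φw≡base = w∉ (coimage (subst (_∈ S) (sym φw≡base) base∈S))
        x₁ : Fin n → A
        x₁ i = if does (i ≟ ℓ) then x base else x i
        x₁-ℓ : x₁ ℓ ≡ x base
        x₁-ℓ rewrite dec-true (ℓ ≟ ℓ) refl = refl
        x₁-off : ∀ {i} → i ≢ ℓ → x₁ i ≡ x i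
        x₁-off {i} i≢ℓ rewrite dec-false (i ≟ ℓ) i≢ℓ = refl
        masks : mask (allBut ℓ ∘ PC.transpose ℓ base) (x ∘ PC.transpose ℓ base) ≗ mask (allBut base) x₁
        masks i rewrite allBut-transpose ℓ base i with i ≟ base
        ... | yes _ = refl
        ... | no i≢base with i ≟ ℓ
        ...   | yes _  = refl
        ...   | no i≢ℓ with i ≟ base
        ...     | yes i≡base = contradiction i≡base i≢base
        ...     | no  _      = refl
        enc : Encodes (allBut base) ℓ x₁ y
        enc = encodes (λ i i≢ℓ → trans (off i i≢ℓ) (sym (x₁-off i≢ℓ)))
                (trans at (trans (total-permute (allBut ℓ) x ℓ base) (sum-cong-≗ masks)))
        reached = proj₂ chained x₁ y enc (trans x₁-ℓ (sym (trans (cong x₁ return) (x₁-off base≢ℓ))))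
        x′ = proj₁ reached
        enc′ = proj₁ (proj₂ reached)
        x′-ℓ = proj₁ (proj₂ (proj₂ reached))
        x′-on = λ {w} → proj₁ (proj₂ (proj₂ (proj₂ reached))) {w}
        x′-off = λ {w} → proj₂ (proj₂ (proj₂ (proj₂ reached))) {w}

  -- A detached cycle costs one instruction more than it has cells. Freezing it lowers `#moved` by
  -- at least its number of cells and the number of detached cycles by at least one.
  computable-m+D : ∀ d (φ : Fin n → Fin n) → #detachedCycles φ ≤ d →
    Computable (manipulation {A = A} φ) (#moved φ + d)
  computable-m+D d φ D≤d with anySubset? (isDetachedCycle? φ)
  ... | no ∄dc = noDetachedCycle⇒computable (#moved φ + d) φ (m≤m+n _ d) (λ dc → ∄dc (_ , dc))
  computable-m+D zero φ D≤0 | yes (S , dc) =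
    contradiction (≤-trans (∈-length (∈-detachedCycles⁺ dc)) D≤0) 1+n≰n
  computable-m+D (suc d) φ D≤d | yes (S , dc) = computable-mono bound
    (cycle-computable dc (computable-m+D d (freeze S φ) (≤-pred (≤-trans (#detachedCycles-freeze dc) D≤d))))
    where
    open Cycle dc using (l)
    open ≤-Reasoning
    bound : suc (suc l) + (#moved (freeze S φ) + d) ≤ #moved φ + suc d
    bound = begin
      suc (suc l + (#moved (freeze S φ) + d)) ≡⟨ cong suc (+-assoc (suc l) _ d) ⟨
      suc (suc l + #moved (freeze S φ) + d)   ≤⟨ s≤s (+-monoˡ-≤ d (#moved-freeze dc)) ⟩
      suc (#moved φ + d)                      ≡⟨ +-suc (#moved φ) d ⟨
      #moved φ + suc d                        ∎

  -- With the sum already in `ℓ`, a detached cycle costs only as many instructions as it has cells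
  -- and leaves a valid sum behind. The recursion ends when no detached cycle remains.
  computable-with-sum : ∀ fuel (φ : Fin n → Fin n) {ℓ} → (∀ i → φ i ≢ ℓ) → #moved φ ≤ fuel →
    ∃[ P ] ∀ x y → Encodes (allBut ℓ) ℓ x y → ∀ i → lookup (run {L = #moved φ} P y) i ≡ x (φ i)
  computable-with-sum fuel φ source m≤fuel with anySubset? (isDetachedCycle? φ)
  ... | no ∄dc with noDetachedCycle⇒computable {A = A} (#moved φ) φ ≤-refl (λ dc → ∄dc (_ , dc))
  ...   | P , computes = P , λ x y enc i → begin
    lookup (run P y) i           ≡⟨ cong (λ z → lookup z i) (computes y) ⟩
    lookup (manipulation φ y) i  ≡⟨ lookup-manipulation φ y i ⟩
    -- No cell reads `ℓ`, so the sum still held there does not enter the result.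
    lookup y (φ i)               ≡⟨ Encodes.off enc (φ i) (source i) ⟩
    x (φ i)                      ∎
    where open ≡-Reasoning
  computable-with-sum zero φ source m≤0 | yes (S , dc) =
    contradiction (≤-trans (∈-length (∈-moved⁺ (Cycle.base-moved dc))) m≤0) 1+n≰n
  computable-with-sum {n} (suc fuel) φ {ℓ} source m≤fuel | yes (S , dc) = result
    where
    open Cycle dc using (l; preimage)
    ψ : Fin n → Fin n
    ψ = freeze S φ
    ψ-source : ∀ i → ψ i ≢ ℓ
    ψ-source i with i ∈? S
    ... | no  _  = source i
    -- A frozen cell reads itself, but it has a preimage under `φ` and so differs from `ℓ`.
    ... | yes i∈ = λ i≡ℓ → source (proj₁ (preimage i∈)) (trans (proj₂ (proj₂ (preimage i∈))) i≡ℓ)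
    result : ∃[ P ] ∀ x y → Encodes (allBut ℓ) ℓ x y → ∀ i → lookup (run {L = #moved φ} P y) i ≡ x (φ i)
    result with cycle-in-sum dc source
              | computable-with-sum fuel ψ ψ-source
                  (≤-pred (≤-trans (s≤s (m≤n+m _ l)) (≤-trans (#moved-freeze dc) m≤fuel)))
    ... | P , P-ok | Q , Q-ok with pad (P Vec.++ Q) (#moved-freeze dc)
    ...   | R , R≗ = R , λ x y enc i →
      let (x′ , enc′ , x′ψ) = P-ok x y enc in begin
      lookup (run R y) i              ≡⟨ cong (λ z → lookup z i) (trans (R≗ y) (run-++ P Q y)) ⟩
      lookup (run Q (run P y)) i      ≡⟨ Q-ok x′ (run P y) enc′ i ⟩
      x′ (ψ i)                        ≡⟨ x′ψ i ⟩
      x (φ i)                         ∎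
      where open ≡-Reasoning

  computable-1+m : ∀ (φ : Fin n → Fin n) {ℓ} → (∀ i → φ i ≢ ℓ) →
    Computable (manipulation {A = A} φ) (suc (#moved φ))
  computable-1+m φ {ℓ} source with computable-with-sum (#moved φ) φ source ≤-refl
  ... | P , P-ok = assign ℓ (λ y → total (allBut ℓ) (lookup y)) Vec.∷ P , λ y →
    lookup-extensionality (λ i → trans
      (P-ok (lookup y) _ (encodes (λ i i≢ℓ → Vecₚ.lookup∘update′ i≢ℓ y _) (Vecₚ.lookup∘update ℓ y _)) i)
      (sym (lookup-manipulation φ y i)))

-- The cyclic group structure on a finite set

module CyclicGroup {A : Set a} {q : ℕ} .{{_ : NonZero q}} (A↔Fin : A ↔ Fin q) where

  open Inverse A↔Fin using (to; from; strictlyInverseˡ; strictlyInverseʳ)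

  code : A → ℕ
  code = toℕ ∘ to

  residue : ℕ → A
  residue m = from (m mod q)

  code-residue : ∀ m → code (residue m) ≡ m % q
  code-residue m = trans (cong toℕ (strictlyInverseˡ (m mod q))) (toℕ-fromℕ< (m%n<n m q))

  residue-cong : ∀ {m k} → m % q ≡ k % q → residue m ≡ residue k
  residue-cong {m} {k} eq = cong from (toℕ-injective
    (trans (toℕ-fromℕ< (m%n<n m q)) (trans eq (sym (toℕ-fromℕ< (m%n<n k q))))))

  residue-code : ∀ x → residue (code x) ≡ x
  residue-code x = trans (cong from (toℕ-injective
    (trans (toℕ-fromℕ< (m%n<n (code x) q)) (m<n⇒m%n≡m (toℕ<n (to x)))))) (strictlyInverseʳ x)

  residue-+ : ∀ m k → residue (code (residue m) + k) ≡ residue (m + k)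
  residue-+ m k = residue-cong (begin
    (code (residue m) + k) % q   ≡⟨ cong (λ c → (c + k) % q) (code-residue m) ⟩
    (m % q + k) % q              ≡⟨ %-distribˡ-+ (m % q) k q ⟩
    (m % q % q + k % q) % q      ≡⟨ cong (λ r → (r + k % q) % q) (m%n%n≡m%n m q) ⟩
    (m % q + k % q) % q          ≡⟨ %-distribˡ-+ m k q ⟨
    (m + k) % q                  ∎)
    where open ≡-Reasoning

  _∙_ : A → A → A
  x ∙ y = residue (code x + code y)

  ε : A
  ε = residue 0

  _⁻¹ : A → A
  x ⁻¹ = residue (q ∸ code x)

  ∙-comm : ∀ x y → x ∙ y ≡ y ∙ x
  ∙-comm x y = cong residue (+-comm (code x) (code y))

  ∙-assoc : ∀ x y z → (x ∙ y) ∙ z ≡ x ∙ (y ∙ z)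
  ∙-assoc x y z = begin
    (x ∙ y) ∙ z                           ≡⟨ residue-+ (code x + code y) (code z) ⟩
    -- Since `residue-+` reduces only a left summand, the sum is rotated to bring `y ∙ z` to the
    -- left.
    residue (code x + code y + code z)    ≡⟨ cong residue (trans (+-assoc (code x) _ _) (+-comm (code x) _)) ⟩
    residue (code y + code z + code x)    ≡⟨ residue-+ (code y + code z) (code x) ⟨
    (y ∙ z) ∙ x                           ≡⟨ ∙-comm (y ∙ z) x ⟩
    x ∙ (y ∙ z)                           ∎
    where open ≡-Reasoning

  ∙-identityˡ : ∀ x → ε ∙ x ≡ x
  ∙-identityˡ x = trans (residue-+ 0 (code x)) (residue-code x)

  ∙-inverseˡ : ∀ x → (x ⁻¹) ∙ x ≡ ε
  ∙-inverseˡ x = trans (residue-+ (q ∸ code x) (code x))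
    (residue-cong (trans (cong (_% q) (m∸n+n≡m (<⇒≤ (toℕ<n (to x))))) ([m+n]%n≡m%n 0 q)))

  isAbelianGroup : IsAbelianGroup _≡_ _∙_ ε _⁻¹
  isAbelianGroup = record
    { isGroup = record
      { isMonoid = record
        { isSemigroup = record
          { isMagma = record { isEquivalence = isEquivalence ; ∙-cong = cong₂ _∙_ }
          ; assoc = ∙-assoc }
        ; identity = ∙-identityˡ , λ x → trans (∙-comm x ε) (∙-identityˡ x) }
      ; inverse = ∙-inverseˡ , λ x → trans (∙-comm x (x ⁻¹)) (∙-inverseˡ x)
      ; ⁻¹-cong = cong _⁻¹ }
    ; comm = ∙-comm }

-- Lower bounds

-- An instruction with a designated cell, so that updates can be counted. The coordinate function at
-- `target` may be trivial as well.
record Step (A : Set a) (n : ℕ) : Set a where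
  field
    target  : Fin n
    apply   : Transformation A n
    trivial : ∀ {j} → j ≢ target → IsTrivialAt apply j

open Step

targets : List (Step A n) → List (Fin n)
targets = map target

execute : List (Step A n) → Transformation A n
execute []       x = x
execute (s ∷ ss) x = execute ss (apply s x)

execute-++ : ∀ (ss ts : List (Step A n)) x → execute (ss ++ ts) x ≡ execute ts (execute ss x)
execute-++ []       ts x = refl
execute-++ (s ∷ ss) ts x = execute-++ ss ts (apply s x)

untouched : ∀ (ss : List (Step A n)) {i} → i ∉ₗ targets ss → IsTrivialAt (execute ss) i
untouched []       _ x = refl
untouched (s ∷ ss) i∉ x = trans (untouched ss (i∉ ∘ there) (apply s x)) (trivial s (i∉ ∘ here) x)

-- The bracketing keeps the prefix up to and including the first update in `S` together, as its
-- effect is studied as a whole.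
first-in : ∀ (S : Subset n) (ss : List (Step A n)) → ∀ {i} → i ∈ S → i ∈ₗ targets ss →
  ∃[ ls ] ∃[ s ] ∃[ rs ] ss ≡ (ls ++ s ∷ []) ++ rs × target s ∈ S × (∀ {j} → j ∈ S → j ∉ₗ targets ls)
first-in S (s ∷ ss) i∈S i∈ with target s ∈? S
... | yes s∈S = [] , s , ss , refl , s∈S , λ _ ()
first-in S (s ∷ ss) i∈S (here refl) | no s∉S = contradiction i∈S s∉S
first-in S (s ∷ ss) i∈S (there i∈)  | no s∉S with first-in S ss i∈S i∈
... | ls , t , rs , refl , t∈S , avoids = s ∷ ls , t , rs , refl , t∈S ,
      λ { j∈S (here refl) → s∉S j∈S ; j∈S (there j∈) → avoids j∈S j∈ }

-- Counting repeated updates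

open module Count {n} = Counting (_≟_ {n})

_∈ₗ?_ : (i : Fin n) (is : List (Fin n)) → Dec (i ∈ₗ is)
_∈ₗ?_ = DecMembershipₗ._∈?_ _≟_

∈-both⇒2≤count : ∀ {i : Fin n} {xs ys} → i ∈ₗ xs → i ∈ₗ ys → 2 ≤ count i (xs ++ ys)
∈-both⇒2≤count {i = i} {xs} {ys} i∈xs i∈ys =
  ≤-trans (+-mono-≤ (∈⇒0<count i∈xs) (∈⇒0<count i∈ys)) (≤-reflexive (sym (count-++ i xs ys)))

-- Distinct detached cycles are disjoint, so the cells chosen from them are distinct.
choose-targets : ∀ (φ : Fin n → Fin n) ts →
  (∀ {S} → IsDetachedCycle φ S → ∃[ i ] i ∈ S × 2 ≤ count i ts) →
  ∀ {Ss} → Uniqueₗ Ss → (∀ {S} → S ∈ₗ Ss → IsDetachedCycle φ S) →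
  ∃[ W ] length W ≡ length Ss × Uniqueₗ W ×
    (∀ {w} → w ∈ₗ W → 2 ≤ count w ts × ∃[ S ] S ∈ₗ Ss × w ∈ S)
choose-targets φ ts twice [] _ = [] , refl , [] , λ ()
choose-targets φ ts twice {S ∷ Ss} (S∉ ∷ u) dcs
  with twice (dcs (here refl)) | choose-targets φ ts twice u (dcs ∘ there)
... | i , i∈S , 2≤i | W , length≡ , W-unique , W-ok =
  i ∷ W , cong suc length≡ , Allₚ.¬Any⇒All¬ W i∉W ∷ W-unique , λ
    { (here refl) → 2≤i , S , here refl , i∈S
    ; (there w∈)  → let (2≤w , T , T∈ , w∈T) = W-ok w∈ in 2≤w , T , there T∈ , w∈T }
  where
  i∉W : i ∉ₗ W
  i∉W i∈W with W-ok i∈W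
  ... | _ , T , T∈ , i∈T = All.lookup S∉ T∈ (detachedCycles-disjoint (dcs (here refl)) (dcs (there T∈)) i∈S i∈T)

-- A cell of `W` occurs at most twice in `W ++ us`, any other cell at most once, and `ts` contains
-- it at least that often.
length-twice : ∀ {W us ts : List (Fin n)} → Uniqueₗ W → (∀ {w} → w ∈ₗ W → 2 ≤ count w ts) →
  Uniqueₗ us → (∀ {i} → i ∈ₗ us → i ∈ₗ ts) → length W + length us ≤ length ts
length-twice {W = W} {us} {ts} W-unique twice us-unique us⊆ts =
  subst (_≤ length ts) (length-++ W) (count-≤⇒length-≤ (W ++ us) ts bound)
  where
  bound : ∀ y → count y (W ++ us) ≤ count y ts
  bound y rewrite count-++ y W us with 1 ≤? count y W
  ... | yes 0<c = ≤-trans (+-mono-≤ (count-unique W-unique) (count-unique us-unique)) (twice (0<count⇒∈ W 0<c))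
  ... | no  0≮c rewrite count-∉ {xs = W} (0≮c ∘ ∈⇒0<count) = count-⊆ us-unique us⊆ts y

module LowerBound {A : Set a} {q : ℕ} (A↔Fin : A ↔ Fin q) (2≤q : 2 ≤ q) where

  open Inverse A↔Fin using (to; from; strictlyInverseˡ; strictlyInverseʳ)

  to-injective : Injective _≡_ _≡_ to
  to-injective {x} {y} eq = trans (sym (strictlyInverseʳ x)) (trans (cong from eq) (strictlyInverseʳ y))

  _≟A_ : DecidableEquality A
  x ≟A y with to x ≟ to y
  ... | yes eq = yes (to-injective eq)
  ... | no neq = no (neq ∘ cong to)

  other : ∀ x → ∃[ y ] x ≢ y
  -- As `2≤q` also proves `1 < q`, this is the element of index 1; `<⇒≤ 2≤q` gives the one of index
  -- 0.
  other x with x ≟A from (fromℕ< 2≤q)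
  ... | no  x≢ = _ , x≢
  ... | yes refl = from (fromℕ< (<⇒≤ 2≤q)) , λ eq →
    1≢0 (trans (sym (toℕ-fromℕ< 2≤q)) (trans
      (cong toℕ (trans (sym (strictlyInverseˡ _)) (trans (cong to eq) (strictlyInverseˡ _))))
      (toℕ-fromℕ< (<⇒≤ 2≤q))))
    where
    1≢0 : 1 ≢ 0
    1≢0 ()

  inhabitant : A
  inhabitant = from (fromℕ< 2≤q)

  encode : Vec A n → Fin (q ^ n)
  encode x = funToFin (to ∘ lookup x)

  encode-injective : Injective _≡_ _≡_ (encode {n})
  encode-injective {x = x} {y} eq = lookup-extensionality (λ i → to-injective (begin
    to (lookup x i)          ≡⟨ finToFun-funToFin (to ∘ lookup x) i ⟨
    finToFun (encode x) i    ≡⟨ cong (λ c → finToFun c i) eq ⟩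
    finToFun (encode y) i    ≡⟨ finToFun-funToFin (to ∘ lookup y) i ⟩
    to (lookup y i)          ∎))
    where open ≡-Reasoning

  -- The orbit of `y` returns to `y`, and the last iterate before the return is a preimage.
  injective⇒surjective : ∀ {h : Transformation A n} → Injective _≡_ _≡_ h → ∀ y → ∃[ x ] h x ≡ y
  injective⇒surjective {h = h} h-inj y with iterate-returns {code = encode} encode-injective h-inj y
  ... | k , eq = iterate h y k , trans (sym (iterate-suc h y k)) eq

  trivial-stable : ∀ (f : Transformation A n) i → ¬ ¬ IsTrivialAt f i → IsTrivialAt f i
  trivial-stable f i ¬¬t x = decidable-stable (lookup (f x) i ≟A lookup x i) (λ neq → ¬¬t (λ t → neq (t x)))

  -- Whether an instruction has a nontrivial coordinate can be decided by
  -- a search through A^n, but the double negation is all that is needed.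
  to-steps : ∀ {M} (p : Program A n M) → ¬ ¬ (∃[ ss ] length ss ≤ M × execute ss ≗ run p)
  to-steps Vec.[] k = k ([] , z≤n , λ _ → refl)
  to-steps {n} {suc M} ((f , isInstruction) Vec.∷ p) k = to-steps p λ (ss , ss≤M , ss≗p) →
    let active : ∀ i → ¬ ¬ IsTrivialAt f i
        active i ¬triv = k
          ( record { target = i ; apply = f
                   ; trivial = λ {j} j≢i → trivial-stable f j (λ ¬trivⱼ → j≢i (isInstruction j i ¬trivⱼ ¬triv)) } ∷ ss
          , s≤s ss≤M , λ x → ss≗p (f x))
        f≗id : ∀ x → f x ≡ x
        f≗id x = lookup-extensionality (λ i → trivial-stable f i (active i) x)
    in k (ss , ≤-trans ss≤M (<⇒≤ (n<1+n M)) , λ x → trans (ss≗p x) (cong (run p) (sym (f≗id x))))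

  module _ {φ : Fin n → Fin n} {ss : List (Step A n)} (computes : execute ss ≗ manipulation φ) where

    final : ∀ x i → lookup (execute ss x) i ≡ lookup x (φ i)
    final x i = trans (cong (λ y → lookup y i) (computes x)) (lookup-manipulation φ x i)

    -- An untouched cell keeps `x i`, which differs from the required `x (φ i)` for a suitable `x`.
    moved⇒target : ∀ {i} → φ i ≢ i → i ∈ₗ targets ss
    moved⇒target {i} φi≢i = decidable-stable (i ∈ₗ? targets ss) λ i∉ →
      proj₂ (other inhabitant) (begin
        inhabitant                     ≡⟨ Vecₚ.lookup-replicate (φ i) inhabitant ⟨
        lookup x₀ (φ i)                ≡⟨ Vecₚ.lookup∘update′ φi≢i x₀ _ ⟨
        lookup x (φ i)                 ≡⟨ final x i ⟨
        lookup (execute ss x) i        ≡⟨ untouched ss i∉ x ⟩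
        lookup x i                     ≡⟨ Vecₚ.lookup∘update i x₀ _ ⟩
        proj₁ (other inhabitant)       ∎)
      where
      open ≡-Reasoning
      x₀ x : Vec A n
      x₀ = Vec.replicate n inhabitant
      x  = x₀ [ i ]≔ proj₁ (other inhabitant)

    module FirstUpdate {S} (dc : IsDetachedCycle φ S) where

      open Cycle dc

      private
        split = first-in S ss base∈S (moved⇒target base-moved)
        ls    = proj₁ split
        s     = proj₁ (proj₂ split)
        rs    = proj₁ (proj₂ (proj₂ split))
        ss≡   = proj₁ (proj₂ (proj₂ (proj₂ split)))

      i : Fin n
      i = target s

      i∈S : i ∈ S
      i∈S = proj₁ (proj₂ (proj₂ (proj₂ (proj₂ split))))

      avoids : ∀ {j} → j ∈ S → j ∉ₗ targets ls
      avoids = proj₂ (proj₂ (proj₂ (proj₂ (proj₂ split))))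

      early : List (Step A n)
      early = ls ++ s ∷ []

      middle : Transformation A n
      middle = execute early

      execute-middle : ∀ x → execute ss x ≡ execute rs (middle x)
      execute-middle x = trans (cong (λ ss → execute ss x) ss≡) (execute-++ early rs x)

      i∈early : i ∈ₗ targets early
      i∈early = subst (i ∈ₗ_) (sym (map-++ target ls (s ∷ []))) (∈-++⁺ʳ (targets ls) (here refl))

      ∈early⇒≡i : ∀ {j} → j ∈ S → j ∈ₗ targets early → j ≡ i
      ∈early⇒≡i {j} j∈S j∈ with ∈-++⁻ (targets ls) (subst (j ∈ₗ_) (map-++ target ls (s ∷ [])) j∈)
      ... | inj₁ j∈ls       = contradiction j∈ls (avoids j∈S)
      ... | inj₂ (here j≡i) = j≡i

      -- A cell already updated and never updated again holds its final value.
      once⇒final : ∀ {j} → count j (targets ss) < 2 → j ∈ₗ targets early → ∀ x →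
        lookup (middle x) j ≡ lookup x (φ j)
      once⇒final {j} once j∈ x = begin
        lookup (middle x) j               ≡⟨ untouched rs j∉ (middle x) ⟨
        lookup (execute rs (middle x)) j  ≡⟨ cong (λ y → lookup y j) (execute-middle x) ⟨
        lookup (execute ss x) j           ≡⟨ final x j ⟩
        lookup x (φ j)                    ∎
        where
        open ≡-Reasoning
        j∉ : j ∉ₗ targets rs
        j∉ j∈rs = 1+n≰n (≤-trans once (subst (λ ts → 2 ≤ count j ts)
          (trans (sym (map-++ target early rs)) (cong targets (sym ss≡))) (∈-both⇒2≤count j∈ j∈rs)))

      -- If no cell were updated twice, x i would be lost after the first
      -- update in S: every cell j then holds x j, for j ≢ i, or x (φ j), and
      -- the only cell of S updated so far is i.
      some-target-twice : ∃[ j ] 2 ≤ count j (targets ss)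
      some-target-twice with any? (λ j → 2 ≤? count j (targets ss))
      ... | yes found = found
      ... | no  none  = ⊥-elim (proj₂ (other inhabitant) (begin
        inhabitant                  ≡⟨ Vecₚ.lookup-replicate i inhabitant ⟨
        lookup x₀ i                 ≡⟨ cong (lookup x₀) φp≡i ⟨
        lookup x₀ (φ p)             ≡⟨ final x₀ p ⟨
        lookup (execute ss x₀) p    ≡⟨ cong (λ y → lookup y p) (trans (execute-middle x₀)
                                        (trans (cong (execute rs) (lookup-extensionality same)) (sym (execute-middle x)))) ⟩
        lookup (execute ss x) p     ≡⟨ final x p ⟩
        lookup x (φ p)              ≡⟨ cong (lookup x) φp≡i ⟩
        lookup x i                  ≡⟨ Vecₚ.lookup∘update i x₀ _ ⟩
        proj₁ (other inhabitant)    ∎))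
        where
        open ≡-Reasoning
        p    = proj₁ (preimage i∈S)
        φp≡i = proj₂ (proj₂ (preimage i∈S))
        x₀ x : Vec A n
        x₀ = Vec.replicate n inhabitant
        x  = x₀ [ i ]≔ proj₁ (other inhabitant)
        off-i : ∀ {j} → j ≢ i → lookup x₀ j ≡ lookup x j
        off-i j≢i = sym (Vecₚ.lookup∘update′ j≢i x₀ _)
        same : ∀ j → lookup (middle x₀) j ≡ lookup (middle x) j
        same j with j ∈ₗ? targets early
        ... | no  j∉ = trans (untouched early j∉ x₀)
                (trans (off-i (λ { refl → j∉ i∈early })) (sym (untouched early j∉ x)))
        ... | yes j∈ = trans (once⇒final once j∈ x₀) (trans (off-i φj≢i) (sym (once⇒final once j∈ x)))
          where
          once : count j (targets ss) < 2
          once = ≰⇒> (λ 2≤ → none (j , 2≤))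
          φj≢i : φ j ≢ i
          -- By detachment, a cell reading `i` lies in `S`; updated this early, it can only be `i`
          -- itself, which is not fixed.
          φj≢i φj≡i with ∈early⇒≡i (coimage (subst (_∈ S) (sym φj≡i) i∈S)) j∈
          ... | refl = ∈⇒moved i∈S φj≡i

      -- All instructions of a program for a permutation are injective, but an
      -- instruction setting i to x (φ i) while φ i still holds x (φ i) is not.
      cycle-target-twice : IsPermutation φ → ∃[ j ] j ∈ S × 2 ≤ count j (targets ss)
      cycle-target-twice (_ , φ-surj) with 2 ≤? count i (targets ss)
      ... | yes 2≤ = i , i∈S , 2≤
      ... | no  ≱2 = ⊥-elim (proj₂ (other (lookup z₀ i))
        (trans (cong (λ z → lookup z i) z₀≡z) (Vecₚ.lookup∘update i z₀ _)))
        where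
        open ≡-Reasoning
        before : Transformation A n
        before = execute ls
        execute-before : ∀ x → execute ss x ≡ execute (s ∷ rs) (before x)
        execute-before x = trans (execute-middle x) (cong (execute rs) (execute-++ ls (s ∷ []) x))
        execute-injective : ∀ {x y} → execute ss x ≡ execute ss y → x ≡ y
        execute-injective {x} {y} eq = lookup-extensionality λ j →
          let (j′ , φj′≡) = φ-surj j
              φj′≡j = φj′≡ refl in begin
          lookup x j                ≡⟨ cong (lookup x) φj′≡j ⟨
          lookup x (φ j′)           ≡⟨ final x j′ ⟨
          lookup (execute ss x) j′  ≡⟨ cong (λ z → lookup z j′) eq ⟩
          lookup (execute ss y) j′  ≡⟨ final y j′ ⟩
          lookup y (φ j′)           ≡⟨ cong (lookup y) φj′≡j ⟩
          lookup y j                ∎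
        before-injective : Injective _≡_ _≡_ before
        before-injective {x} {y} eq = execute-injective
          (trans (execute-before x) (trans (cong (execute (s ∷ rs)) eq) (sym (execute-before y))))
        -- The states `z₀` and `z` differ only at `i`. Being injective on a finite set, `before`
        -- reaches `z` too, so both states can occur just before `s`, which sends them to the same
        -- state.
        x₀ z₀ z x : Vec A n
        x₀ = Vec.replicate n inhabitant
        z₀ = before x₀
        z  = z₀ [ i ]≔ proj₁ (other (lookup z₀ i))
        x  = proj₁ (injective⇒surjective before-injective z)
        before-x : before x ≡ z
        before-x = proj₂ (injective⇒surjective before-injective z)
        apply-at-i : ∀ x → lookup (apply s (before x)) i ≡ lookup (before x) (φ i)
        apply-at-i x = begin
          lookup (apply s (before x)) i  ≡⟨ cong (λ y → lookup y i) (execute-++ ls (s ∷ []) x) ⟨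
          lookup (middle x) i            ≡⟨ once⇒final (≰⇒> ≱2) i∈early x ⟩
          lookup x (φ i)                 ≡⟨ untouched ls (avoids (image i∈S)) x ⟨
          lookup (before x) (φ i)        ∎
        same : ∀ j → lookup (apply s z₀) j ≡ lookup (apply s z) j
        same j with j ≟ i
        ... | no j≢i = trans (trivial s j≢i z₀)
                (trans (sym (Vecₚ.lookup∘update′ j≢i z₀ _)) (sym (trivial s j≢i z)))
        ... | yes refl = begin
          lookup (apply s z₀) i          ≡⟨ apply-at-i x₀ ⟩
          lookup z₀ (φ i)                ≡⟨ Vecₚ.lookup∘update′ (∈⇒moved i∈S) z₀ _ ⟨
          lookup z (φ i)                 ≡⟨ cong (λ z → lookup z (φ i)) before-x ⟨
          lookup (before x) (φ i)        ≡⟨ apply-at-i x ⟨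
          lookup (apply s (before x)) i  ≡⟨ cong (λ z → lookup (apply s z) i) before-x ⟩
          lookup (apply s z) i           ∎
        z₀≡z : z₀ ≡ z
        z₀≡z = begin
          z₀        ≡⟨ cong before (execute-injective (begin
            execute ss x₀                ≡⟨ execute-before x₀ ⟩
            execute rs (apply s z₀)      ≡⟨ cong (execute rs) (lookup-extensionality same) ⟩
            execute rs (apply s z)       ≡⟨ cong (λ z → execute rs (apply s z)) before-x ⟨
            execute (s ∷ rs) (before x)  ≡⟨ execute-before x ⟨
            execute ss x                 ∎)) ⟩
          before x  ≡⟨ before-x ⟩
          z         ∎

  -- The order on numbers is decidable, which absorbs the double negation in `to-steps`.
  lower-bound : ∀ {φ : Fin n → Fin n} L →
    (∀ (ss : List (Step A n)) → execute ss ≗ manipulation φ → L ≤ length ss) →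
    ∀ {M} (p : Program A n M) → Computes p (manipulation φ) → L ≤ M
  lower-bound L bound {M} p computes = decidable-stable (L ≤? M) λ L≰M →
    to-steps p λ (ss , ss≤M , ss≗p) → L≰M (≤-trans (bound ss (λ x → trans (ss≗p x) (computes x))) ss≤M)

  twice-bound : ∀ {φ : Fin n → Fin n} {ss : List (Step A n)} → execute ss ≗ manipulation φ →
    ∀ {W} → Uniqueₗ W → (∀ {w} → w ∈ₗ W → 2 ≤ count w (targets ss)) → #moved φ + length W ≤ length ss
  twice-bound {φ = φ} {ss} computes {W} W-unique twice =
    subst₂ _≤_ (+-comm (length W) (#moved φ)) (length-map target ss)
      (length-twice W-unique twice (moved-unique φ) (moved⇒target {ss = ss} computes ∘ ∈-moved⁻))

  m≤length : ∀ {φ : Fin n → Fin n} (ss : List (Step A n)) → execute ss ≗ manipulation φ → #moved φ ≤ length ss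
  m≤length {φ = φ} ss computes = ≤-trans (m≤m+n _ 0) (twice-bound {φ = φ} {ss} computes [] (λ ()))

  m+1≤length : ∀ {φ : Fin n → Fin n} {S} → IsDetachedCycle φ S →
    ∀ (ss : List (Step A n)) → execute ss ≗ manipulation φ → #moved φ + 1 ≤ length ss
  m+1≤length {φ = φ} dc ss computes with FirstUpdate.some-target-twice {ss = ss} computes dc
  ... | j , 2≤ = twice-bound {φ = φ} {ss} computes ([] ∷ []) (λ { (here refl) → 2≤ })

  m+D≤length : ∀ {φ : Fin n → Fin n} → IsPermutation φ →
    ∀ (ss : List (Step A n)) → execute ss ≗ manipulation φ → #moved φ + #detachedCycles φ ≤ length ss
  m+D≤length {φ = φ} φ-perm ss computes
    with choose-targets φ (targets ss) (λ dc → FirstUpdate.cycle-target-twice {ss = ss} computes dc φ-perm)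
           (detachedCycles-unique φ) ∈-detachedCycles⁻
  ... | W , length≡ , W-unique , W-ok = subst (λ d → #moved φ + d ≤ length ss) length≡
    (twice-bound {φ = φ} {ss} computes W-unique (proj₁ ∘ W-ok))

-- The exact complexity in the three cases

0<D⇒detachedCycle : ∀ {φ : Fin n → Fin n} → #detachedCycles φ > 0 → ∃[ S ] IsDetachedCycle φ S
0<D⇒detachedCycle {n} {φ} 0<D with anySubset? (isDetachedCycle? φ)
... | yes found = found
... | no  ∄dc   = contradiction (subst (0 <_) D≡0 0<D) 1+n≰n
  where
  D≡0 : #detachedCycles φ ≡ 0
  D≡0 = cong length (filter-none (isDetachedCycle? φ) (All.universal (λ S dc → ∄dc (S , dc)) (allSubsets n)))

-- Otherwise `φ` would be onto and, on a finite set, also injective.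
¬permutation⇒source : ∀ {φ : Fin n → Fin n} → ¬ IsPermutation φ → ∃[ ℓ ] ∀ i → φ i ≢ ℓ
¬permutation⇒source {φ = φ} ¬perm with source? φ
... | inj₁ source = source
... | inj₂ surj   = ⊥-elim (¬perm
  (strictlySurjective⇒injective surj , λ j → proj₁ (surj j) , λ { refl → proj₂ (surj j) }))

theorem4 :
    ∀ {a} {A : Set a} {q : ℕ} → A ↔ Fin q → 2 ≤ q →
    ∀ {n} → 2 ≤ n → (φ : Fin n → Fin n) →
    let F = #fixedPoints φ
        D = #detachedCycles φ
    in (IsPermutation φ → HasProceduralComplexity (manipulation {A = A} φ) (n ∸ F + D))
     × (¬ IsPermutation φ → D > 0 → HasProceduralComplexity (manipulation {A = A} φ) (n ∸ F + 1))
     × (¬ IsPermutation φ → ¬ (D > 0) → HasProceduralComplexity (manipulation {A = A} φ) (n ∸ F))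
-- Matching on `q` provides the `NonZero` instance for the cyclic group, and the rewriting turns
-- `n ∸ F` into `#moved φ`.
theorem4 {A = A} {q = suc _} A↔Fin 2≤q {n} _ φ rewrite sym (#moved≡n∸F φ) =
  (λ perm → computable-m+D _ φ ≤-refl , lower-bound _ (m+D≤length perm)) ,
  (λ ¬perm 0<D →
    computable-mono (≤-reflexive (+-comm 1 (#moved φ))) (computable-1+m φ (proj₂ (¬permutation⇒source ¬perm))) ,
    lower-bound _ (m+1≤length (proj₂ (0<D⇒detachedCycle 0<D)))) ,
  (λ _ D≯0 →
    computable-mono (≤-reflexive (+-identityʳ (#moved φ))) (computable-m+D 0 φ (≮⇒≥ D≯0)) ,
    lower-bound _ m≤length)
  where
  open Encoding (CyclicGroup.isAbelianGroup A↔Fin)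
  open LowerBound A↔Fin 2≤q
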